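{- There is no $PG(3,2)$-free matroid $M$ with $|M|>(1-3\cdot 2^{ -4})2^{r(M)}$ and $\chi(M)>4$.
   Context: A matroid $M$ means a simple binary matroid, represented by an integer $r(M)\geq 0$ (its rank) and a set $E(M)\subseteq \mathbb{F}_2^{r(M)}\setminus\{0\}$ that spans $\mathbb{F}_2^{r(M)}$; $|M|:=|E(M)|$. The critical number $\chi(M)$ is the smallest $k$ such that some subspace of $\mathbb{F}_2^{r(M)}$ of codimension $k$ is disjoint from $E(M)$. A matroid $M$ contains a matroid $N$ if there is an injective linear map $\iota:\mathbb{F}_2^{r(N)}\to\mathbb{F}_2^{r(M)}$ with $\iota(E(N))\subseteq E(M)$; $M$ is $N$-free if it does not contain $N$. The projective geometry $PG(s-1,2)$ is the matroid of rank $s$ with edge set $\mathbb{F}_2^s\setminus\{0\}$. -}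

module Defs where

open import Data.Bool using (Bool; true; false; _xor_; _∧_; if_then_else_)
open import Data.Nat using (ℕ; zero; suc; _+_; _<_)
open import Data.Vec using (Vec; []; _∷_; replicate; zipWith; foldr; map)
open import Data.List using (List; []; _∷_; _++_)
import Data.List as L
open import Data.List.Relation.Unary.All using (All)
open import Data.Product using (Σ; ∃; _×_; _,_)
import Data.List.Relation.Unary.All as All
open import Relation.Binary.PropositionalEquality using (_≡_)
open import Relation.Nullary using (¬_)
open import Function.Definitions using (Injective)

𝔽₂^ : ℕ → Set
𝔽₂^ n = Vec Bool n

0v : ∀ {n} → 𝔽₂^ n
0v = replicate _ false

_⊕_ : ∀ {n} → 𝔽₂^ n → 𝔽₂^ n → 𝔽₂^ n
_⊕_ = zipWith _xor_

_·_ : ∀ {n} → 𝔽₂^ n → 𝔽₂^ n → Bool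
x · y = foldr _ _xor_ false (zipWith _∧_ x y)

vsum : ∀ {n} → List (𝔽₂^ n) → 𝔽₂^ n
vsum = L.foldr _⊕_ 0v

Mat : ℕ → ℕ → Set
Mat m n = Vec (𝔽₂^ n) m

apply : ∀ {m n} → Mat m n → 𝔽₂^ n → 𝔽₂^ m
apply A x = map (λ row → row · x) A

rowComb : ∀ {m n} → Mat m n → 𝔽₂^ m → 𝔽₂^ n
rowComb [] [] = 0v
rowComb (r ∷ A) (c ∷ cs) = (if c then r else 0v) ⊕ rowComb A cs

allVecs : (n : ℕ) → List (𝔽₂^ n)
allVecs zero = [] ∷ []
allVecs (suc n) = L.map (false ∷_) (allVecs n) ++ L.map (true ∷_) (allVecs n)

count : ∀ {A : Set} → (A → Bool) → List A → ℕ
count P [] = 0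
count P (x ∷ xs) = (if P x then 1 else 0) + count P xs

-- A simple binary matroid: rank r and a set E ⊆ 𝔽₂ʳ ∖ {0} spanning 𝔽₂ʳ
-- (E given by its (decidable) characteristic function).
record Matroid : Set where
  field
    r     : ℕ
    E     : 𝔽₂^ r → Bool
    0∉E   : E 0v ≡ false
    spans : ∀ (v : 𝔽₂^ r) → Σ (List (𝔽₂^ r)) λ xs → All (λ x → E x ≡ true) xs × vsum xs ≡ v
open Matroid public

size : Matroid → ℕ
size M = count (E M) (allVecs (r M))

-- Subspace of 𝔽₂ʳ of codimension k: the kernel {x | Ax = 0} of a k×r matrix A
-- with linearly independent rows.
IndepRows : ∀ {k n} → Mat k n → Set
IndepRows {k} A = ∀ (c : 𝔽₂^ k) → ¬ (c ≡ 0v) → ¬ (rowComb A c ≡ 0v)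

HasDisjointSubspaceOfCodim : Matroid → ℕ → Set
HasDisjointSubspaceOfCodim M k =
  Σ (Mat k (r M)) λ A → IndepRows A × (∀ x → apply A x ≡ 0v → E M x ≡ false)

CriticalNumber : Matroid → ℕ → Set
CriticalNumber M c =
  HasDisjointSubspaceOfCodim M c × (∀ k → k < c → ¬ HasDisjointSubspaceOfCodim M k)

Contains : Matroid → Matroid → Set
Contains M N =
  Σ (Mat (r M) (r N)) λ ι → Injective _≡_ _≡_ (apply ι) ×
    (∀ x → E N x ≡ true → E M (apply ι x) ≡ true)

isNonzero : ∀ {n} → 𝔽₂^ n → Bool
isNonzero [] = false
isNonzero (b ∷ v) = if b then true else isNonzero v

private
  isNonzero-0 : ∀ n → isNonzero (0v {n}) ≡ false
  isNonzero-0 zero = Relation.Binary.PropositionalEquality.refl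
  isNonzero-0 (suc n) = isNonzero-0 n

  spanPG : ∀ n (v : 𝔽₂^ n) → Σ (List (𝔽₂^ n)) λ xs → All (λ x → isNonzero x ≡ true) xs × vsum xs ≡ v
  spanPG n v with isNonzero v in eq
  ... | true  = (v ∷ []) , (eq All.∷ All.[]) , lemma
    where
    open import Data.Vec.Properties using (zipWith-replicate)
    lemma : vsum (v ∷ []) ≡ v
    lemma = go v
      where
      go : ∀ {m} (w : 𝔽₂^ m) → w ⊕ 0v ≡ w
      go [] = Relation.Binary.PropositionalEquality.refl
      go (false ∷ w) = Relation.Binary.PropositionalEquality.cong (false ∷_) (go w)
      go (true ∷ w) = Relation.Binary.PropositionalEquality.cong (true ∷_) (go w)
  ... | false = [] , All.[] , zeroLemma v eq
    where
    zeroLemma : ∀ {m} (w : 𝔽₂^ m) → isNonzero w ≡ false → 0v ≡ w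
    zeroLemma [] _ = Relation.Binary.PropositionalEquality.refl
    zeroLemma (false ∷ w) e = Relation.Binary.PropositionalEquality.cong (false ∷_) (zeroLemma w e)
    zeroLemma (true ∷ w) ()

PG : ℕ → Matroid   -- PG s = PG(s-1,2)
PG s = record { r = s ; E = isNonzero ; 0∉E = isNonzero-0 s ; spans = spanPG s }

{-# OPTIONS --safe #-}
module Submission where

-- Call the complement of E (with 0) S and write N = 2ⁿ. By induction on t = 2, 3, 4 one shows: if E
-- contains no PG(t − 1, 2) and 2ᵗ |S| < 3 N, then some subspace of codimension at most t avoids E.
--
-- t = 2. E is sum-free with |E| > N/4. Since Σ ê(γ)³ = 0, Fourier analysis gives a hyperplane H for
-- which B = E ∖ H fills more than a third of V ∖ H. Then A = E ∩ H has no odd circuit, so that some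
-- functional is 1 on A. Indeed, in the translates of the span of an odd circuit of minimal length
-- 2r + 1 in A, the elements of B give a partial 2-colouring of the (2r − 1)-cube that is constant
-- along edges and flips between antipodes; such a colouring must omit many vertices, whereas
-- minimality makes A sparse in those translates, and |A| + |B| would be at most half of |H|.
--
-- t > 2. E contains a PG(t − 3, 2), with span R, such that {x : x + R ⊆ E} has more than N/3
-- elements. This set is sum-free and hence, as before, without odd circuits: a functional with
-- kernel H is 1 on it. Counting S in H by translates of R, and outside H by translates of a
-- PG(t − 2, 2) in E ∩ H, shows that there is no such PG(t − 2, 2), so the induction applies to E ∩ H.

open import Defs
import Algebra.Properties.CommutativeSemigroup as CommutativeSemigroup
open import Data.Bool using (Bool; true; false; T; _xor_; _∧_; _∨_; not; if_then_else_)
import Data.Bool.Properties as Bool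
open import Data.Bool.Properties
  using (not-¬; ¬-not; not-involutive; xor-assoc; xor-comm; xor-identityʳ; xor-same;
         not-distribˡ-xor; not-distribʳ-xor; ∨-zeroʳ; ∧-zeroʳ; ∧-identityʳ; ∧-comm)
open import Data.Empty using (⊥; ⊥-elim)
open import Data.Fin using (Fin; zero; suc)
open import Data.Fin.Patterns using (0F; 1F; 2F; 3F)
import Data.Integer as ℤ
open ℤ using (ℤ; +_; 0ℤ; 1ℤ)
import Data.Integer.Properties as ℤₚ
import Data.Integer.Solver as ℤ-Solver
open import Data.List as L using (List; []; _∷_; length)
open import Data.List.Relation.Unary.All using (All; []; _∷_)
open import Data.Nat
open import Data.Nat.Properties
open import Data.Nat.Solver using (module +-*-Solver)
open import Data.Product using (Σ; ∃; _×_; _,_; proj₁; proj₂)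
open import Data.Sum using (_⊎_; inj₁; inj₂)
open import Data.Vec using (Vec; []; _∷_; lookup; replicate; zipWith)
open import Data.Vec.Properties
  using (zipWith-assoc; zipWith-comm; zipWith-identityˡ; zipWith-identityʳ; ≡-dec;
         ∷-injectiveˡ; ∷-injectiveʳ)
import Data.Vec.Relation.Unary.All as V
open import Relation.Binary.PropositionalEquality hiding ([_])
open import Relation.Nullary using (¬_; yes; no)

open CommutativeSemigroup +-commutativeSemigroup using () renaming (interchange to +-interchange)
open +-*-Solver using (con; _:*_; _:=_) renaming (solve to ring; _:+_ to _⊞_)
module ℤS = ℤ-Solver.+-*-Solver

-- Linear algebra over 𝔽₂

⊕-assoc : ∀ {n} (x y z : 𝔽₂^ n) → (x ⊕ y) ⊕ z ≡ x ⊕ (y ⊕ z)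
⊕-assoc = zipWith-assoc xor-assoc

⊕-comm : ∀ {n} (x y : 𝔽₂^ n) → x ⊕ y ≡ y ⊕ x
⊕-comm = zipWith-comm xor-comm

⊕-identityˡ : ∀ {n} (x : 𝔽₂^ n) → 0v ⊕ x ≡ x
⊕-identityˡ = zipWith-identityˡ (λ _ → refl)

⊕-identityʳ : ∀ {n} (x : 𝔽₂^ n) → x ⊕ 0v ≡ x
⊕-identityʳ = zipWith-identityʳ xor-identityʳ

⊕-self : ∀ {n} (x : 𝔽₂^ n) → x ⊕ x ≡ 0v
⊕-self [] = refl
⊕-self (b ∷ x) = cong₂ _∷_ (xor-same b) (⊕-self x)

⊕-interchange : ∀ {n} (a b c d : 𝔽₂^ n) → (a ⊕ b) ⊕ (c ⊕ d) ≡ (a ⊕ c) ⊕ (b ⊕ d)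
⊕-interchange a b c d = begin
  (a ⊕ b) ⊕ (c ⊕ d)   ≡⟨ ⊕-assoc a b (c ⊕ d) ⟩
  a ⊕ (b ⊕ (c ⊕ d))   ≡⟨ cong (a ⊕_) (sym (⊕-assoc b c d)) ⟩
  a ⊕ ((b ⊕ c) ⊕ d)   ≡⟨ cong (λ t → a ⊕ (t ⊕ d)) (⊕-comm b c) ⟩
  a ⊕ ((c ⊕ b) ⊕ d)   ≡⟨ cong (a ⊕_) (⊕-assoc c b d) ⟩
  a ⊕ (c ⊕ (b ⊕ d))   ≡⟨ sym (⊕-assoc a c (b ⊕ d)) ⟩
  (a ⊕ c) ⊕ (b ⊕ d)   ∎
  where open ≡-Reasoning

·-distribˡ-⊕ : ∀ {n} (f x y : 𝔽₂^ n) → f · (x ⊕ y) ≡ (f · x) xor (f · y)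
·-distribˡ-⊕ [] [] [] = refl
·-distribˡ-⊕ (a ∷ f) (b ∷ x) (c ∷ y) rewrite ·-distribˡ-⊕ f x y = lem a b c (f · x) (f · y)
  where
  lem : ∀ a b c p q → (a ∧ (b xor c)) xor (p xor q) ≡ ((a ∧ b) xor p) xor ((a ∧ c) xor q)
  lem false b c p q = refl
  lem true false c p q = trans (sym (xor-assoc c p q))
      (trans (cong (_xor q) (xor-comm c p)) (xor-assoc p c q))
  lem true true false false q = refl
  lem true true false true false = refl
  lem true true false true true = refl
  lem true true true false false = refl
  lem true true true false true = refl
  lem true true true true false = refl
  lem true true true true true = refl

·-zeroʳ : ∀ {n} (f : 𝔽₂^ n) → f · 0v ≡ false
·-zeroʳ [] = refl
·-zeroʳ (false ∷ f) = ·-zeroʳ f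
·-zeroʳ (true ∷ f) = ·-zeroʳ f

rowComb-⊕ : ∀ {m n} (A : Mat m n) (c d : 𝔽₂^ m) → rowComb A (c ⊕ d) ≡ rowComb A c ⊕ rowComb A d
rowComb-⊕ [] [] [] = sym (⊕-identityˡ _)
rowComb-⊕ (r ∷ A) (c ∷ cs) (d ∷ ds) = begin
  (if c xor d then r else 0v) ⊕ rowComb A (cs ⊕ ds)
    ≡⟨ cong₂ _⊕_ (scale c d) (rowComb-⊕ A cs ds) ⟩
  ((if c then r else 0v) ⊕ (if d then r else 0v)) ⊕ (rowComb A cs ⊕ rowComb A ds)
                                                                     ≡⟨ ⊕-interchange _ _ _ _ ⟩
  ((if c then r else 0v) ⊕ rowComb A cs) ⊕ ((if d then r else 0v) ⊕ rowComb A ds) ∎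
  where
  open ≡-Reasoning
  scale : ∀ c d → (if c xor d then r else 0v) ≡ (if c then r else 0v) ⊕ (if d then r else 0v)
  scale false d = sym (⊕-identityˡ _)
  scale true false = sym (⊕-identityʳ _)
  scale true true = sym (⊕-self r)

rowComb-zero : ∀ {m n} (A : Mat m n) → rowComb A 0v ≡ 0v
rowComb-zero [] = refl
rowComb-zero (r ∷ A) = trans (⊕-identityˡ _) (rowComb-zero A)

-- A solver for identities between vectors

data Expr (k : ℕ) : Set where
  var  : Fin k → Expr k
  :0   : Expr k
  _:+_ : Expr k → Expr k → Expr k

infixl 6 _:+_

unit : ∀ {k} → Fin k → 𝔽₂^ k
unit zero = true ∷ 0v
unit (suc i) = false ∷ unit i

rowComb-unit : ∀ {k n} (ρ : Mat k n) i → rowComb ρ (unit i) ≡ lookup ρ i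
rowComb-unit (r ∷ ρ) zero = trans (cong (r ⊕_) (rowComb-zero ρ)) (⊕-identityʳ r)
rowComb-unit (r ∷ ρ) (suc i) = trans (⊕-identityˡ _) (rowComb-unit ρ i)

⟦_⟧ : ∀ {k n} → Expr k → Vec (𝔽₂^ n) k → 𝔽₂^ n
⟦ var i ⟧ ρ = lookup ρ i
⟦ :0 ⟧ ρ = 0v
⟦ e :+ f ⟧ ρ = ⟦ e ⟧ ρ ⊕ ⟦ f ⟧ ρ

norm : ∀ {k} → Expr k → 𝔽₂^ k
norm (var i) = unit i
norm :0 = 0v
norm (e :+ f) = norm e ⊕ norm f

norm-sound : ∀ {k n} (e : Expr k) (ρ : Vec (𝔽₂^ n) k) → ⟦ e ⟧ ρ ≡ rowComb ρ (norm e)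
norm-sound (var i) ρ = sym (rowComb-unit ρ i)
norm-sound :0 ρ = sym (rowComb-zero ρ)
norm-sound (e :+ f) ρ =
  trans (cong₂ _⊕_ (norm-sound e ρ) (norm-sound f ρ)) (sym (rowComb-⊕ ρ (norm e) (norm f)))

-- A sum of the vectors in `ρ` depends only on the parity with which each of them occurs. For
-- concrete expressions these parities compute, and `refl` serves as the last argument.
solve : ∀ {k n} (ρ : Vec (𝔽₂^ n) k) (e f : Expr k) → norm e ≡ norm f → ⟦ e ⟧ ρ ≡ ⟦ f ⟧ ρ
solve ρ e f eq = trans (norm-sound e ρ) (trans (cong (rowComb ρ) eq) (sym (norm-sound f ρ)))

-- Sums over 𝔽₂ⁿ

[_] : Bool → ℕ
[ b ] = if b then 1 else 0

∑ : ∀ {n} → (𝔽₂^ n → ℕ) → ℕ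
∑ {zero} f = f []
∑ {suc n} f = ∑ (λ x → f (false ∷ x)) + ∑ (λ x → f (true ∷ x))

# : ∀ {n} → (𝔽₂^ n → Bool) → ℕ
# P = ∑ (λ x → [ P x ])

∑-cong : ∀ {n} {f g : 𝔽₂^ n → ℕ} → (∀ x → f x ≡ g x) → ∑ f ≡ ∑ g
∑-cong {zero} h = h []
∑-cong {suc n} h = cong₂ _+_ (∑-cong (λ x → h (false ∷ x))) (∑-cong (λ x → h (true ∷ x)))

∑-mono : ∀ {n} {f g : 𝔽₂^ n → ℕ} → (∀ x → f x ≤ g x) → ∑ f ≤ ∑ g
∑-mono {zero} h = h []
∑-mono {suc n} h = +-mono-≤ (∑-mono (λ x → h (false ∷ x))) (∑-mono (λ x → h (true ∷ x)))

∑-+ : ∀ {n} (f g : 𝔽₂^ n → ℕ) → ∑ (λ x → f x + g x) ≡ ∑ f + ∑ g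
∑-+ {zero} f g = refl
∑-+ {suc n} f g = trans (cong₂ _+_ (∑-+ (λ x → f (false ∷ x)) _) (∑-+ (λ x → f (true ∷ x)) _))
                        (+-interchange (∑ (λ x → f (false ∷ x))) _ _ _)

∑-*ˡ : ∀ {n} k (f : 𝔽₂^ n → ℕ) → ∑ (λ x → k * f x) ≡ k * ∑ f
∑-*ˡ {zero} k f = refl
∑-*ˡ {suc n} k f = trans (cong₂ _+_ (∑-*ˡ k (λ x → f (false ∷ x))) (∑-*ˡ k (λ x → f (true ∷ x))))
                         (sym (*-distribˡ-+ k (∑ (λ x → f (false ∷ x))) _))

∑-const : ∀ {n} k → ∑ {n} (λ _ → k) ≡ 2 ^ n * k
∑-const {zero} k = sym (+-identityʳ k)
∑-const {suc n} k = trans (cong₂ _+_ (∑-const {n} k) (∑-const {n} k))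
  (trans (sym (*-distribʳ-+ k (2 ^ n) (2 ^ n))) (cong (λ t → (2 ^ n + t) * k) (sym (+-identityʳ (2 ^ n)))))

∑-swap : ∀ {m n} (f : 𝔽₂^ m → 𝔽₂^ n → ℕ) → ∑ (λ x → ∑ (f x)) ≡ ∑ (λ y → ∑ (λ x → f x y))
∑-swap {zero} f = refl
∑-swap {suc m} f = trans (cong₂ _+_ (∑-swap (λ x → f (false ∷ x))) (∑-swap (λ x → f (true ∷ x))))
                         (sym (∑-+ (λ y → ∑ (λ x → f (false ∷ x) y)) _))

∑-shift : ∀ {n} (a : 𝔽₂^ n) (f : 𝔽₂^ n → ℕ) → ∑ (λ x → f (x ⊕ a)) ≡ ∑ f
∑-shift [] f = refl
∑-shift (false ∷ a) f = cong₂ _+_ (∑-shift a (λ x → f (false ∷ x))) (∑-shift a (λ x → f (true ∷ x)))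
∑-shift (true ∷ a) f =
  trans (+-comm (∑ (λ x → f (true ∷ (x ⊕ a)))) _)
        (cong₂ _+_ (∑-shift a (λ x → f (false ∷ x))) (∑-shift a (λ x → f (true ∷ x))))

#-shift : ∀ {n} (a : 𝔽₂^ n) (P : 𝔽₂^ n → Bool) → # (λ x → P (x ⊕ a)) ≡ # P
#-shift a P = ∑-shift a (λ x → [ P x ])

-- Double counting: after the sums are exchanged, each `y` contributes a translate of `P`. The
-- values of `φ` are counted with multiplicity.
∑-translates : ∀ {m n} (φ : 𝔽₂^ m → 𝔽₂^ n) (P : 𝔽₂^ n → Bool) →
               ∑ (λ u → # (λ y → P (u ⊕ φ y))) ≡ 2 ^ m * # P
∑-translates {m} φ P = trans (∑-swap (λ u y → [ P (u ⊕ φ y) ]))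
  (trans (∑-cong (λ y → #-shift (φ y) P)) (∑-const {m} (# P)))

[]-∨ : ∀ p q → [ p ∨ q ] ≤ [ p ] + [ q ]
[]-∨ false q = ≤-refl
[]-∨ true q = s≤s z≤n

#-∨ : ∀ {n} (P Q : 𝔽₂^ n → Bool) → # (λ x → P x ∨ Q x) ≤ # P + # Q
#-∨ P Q = ≤-trans (∑-mono (λ x → []-∨ (P x) (Q x))) (≤-reflexive (∑-+ (λ x → [ P x ]) _))

[]-not : ∀ b → [ b ] + [ not b ] ≡ 1
[]-not false = refl
[]-not true = refl

#-not : ∀ {n} (P : 𝔽₂^ n → Bool) → # P + # (λ x → not (P x)) ≡ 2 ^ n
#-not {n} P = trans (sym (∑-+ (λ x → [ P x ]) _))
  (trans (∑-cong (λ x → []-not (P x))) (trans (∑-const {n} 1) (*-identityʳ (2 ^ n))))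

2^suc : ∀ n → 2 ^ suc n ≡ 2 ^ n + 2 ^ n
2^suc n = cong (λ t → 2 ^ n + t) (+-identityʳ (2 ^ n))

∨-false : ∀ {p q} → p ∨ q ≡ false → p ≡ false × q ≡ false
∨-false {false} e = refl , e
∨-false {true} ()

m+n<o+p : ∀ m n o p → m + n < o + p → m < o ⊎ n < p
m+n<o+p m n o p h with m <? o
... | yes m<o = inj₁ m<o
... | no m≮o with n <? p
...   | yes n<p = inj₂ n<p
...   | no n≮p = ⊥-elim (<⇒≱ h (+-mono-≤ (≮⇒≥ m≮o) (≮⇒≥ n≮p)))

#<⇒∃ : ∀ {n} (P : 𝔽₂^ n → Bool) → # P < 2 ^ n → ∃ λ x → P x ≡ false
#<⇒∃ {zero} P h with P [] in eq
... | false = [] , eq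
... | true = ⊥-elim (<-irrefl refl h)
#<⇒∃ {suc n} P h with m+n<o+p _ _ (2 ^ n) (2 ^ n) (subst (# P <_) (2^suc n) h)
... | inj₁ h₀ = let x , e = #<⇒∃ (λ x → P (false ∷ x)) h₀ in false ∷ x , e
... | inj₂ h₁ = let x , e = #<⇒∃ (λ x → P (true ∷ x)) h₁ in true ∷ x , e

#≡0⇒ : ∀ {n} (P : 𝔽₂^ n → Bool) → # P ≡ 0 → ∀ x → P x ≡ false
#≡0⇒ P h [] with P []
... | false = refl
#≡0⇒ P h (false ∷ x) = #≡0⇒ (λ x → P (false ∷ x)) (m+n≡0⇒m≡0 _ h) x
#≡0⇒ P h (true ∷ x) = #≡0⇒ (λ x → P (true ∷ x)) (m+n≡0⇒n≡0 (# (λ x → P (false ∷ x))) h) x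

-- Colourings of the cube with deleted vertices

1v : ∀ {n} → 𝔽₂^ n
1v = replicate _ true

data Adj : ∀ {m} → 𝔽₂^ m → 𝔽₂^ m → Set where
  flip : ∀ {m} b (y : 𝔽₂^ m) → Adj (b ∷ y) (not b ∷ y)
  step : ∀ {m} b {y z : 𝔽₂^ m} → Adj y z → Adj (b ∷ y) (b ∷ z)

-- q is a colouring of the cube with the vertices in D deleted; its values on D are irrelevant.
Colouring Constant : ∀ {m} → (D q : 𝔽₂^ m → Bool) → Set
Colouring D q = ∀ {y z} → Adj y z → D y ≡ false → D z ≡ false → q y ≡ q z
Constant D q = ∀ y z → D y ≡ false → D z ≡ false → q y ≡ q z

half : ∀ {m} {A : Set} → Bool → (𝔽₂^ (suc m) → A) → 𝔽₂^ m → A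
half b f y = f (b ∷ y)

half-colouring : ∀ {m} {D q : 𝔽₂^ (suc m) → Bool} b → Colouring D q → Colouring (half b D) (half b q)
half-colouring b col a = col (step b a)

-- The surviving edge over `w` joins the two halves.
halves-constant : ∀ {m} {D q : 𝔽₂^ (suc m) → Bool} → Colouring D q →
  (∀ b → Constant (half b D) (half b q)) →
  (w : 𝔽₂^ m) → D (false ∷ w) ≡ false → D (true ∷ w) ≡ false → Constant D q
halves-constant col same w e₀ e₁ (false ∷ y) (false ∷ z) = same false y z
halves-constant col same w e₀ e₁ (true ∷ y) (true ∷ z) = same true y z
halves-constant col same w e₀ e₁ (false ∷ y) (true ∷ z) p q =
  trans (same false y w p e₀) (trans (col (flip false w) e₀ e₁) (same true w z e₁ q))
halves-constant col same w e₀ e₁ (true ∷ y) (false ∷ z) p q =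
  trans (same true y w p e₁) (trans (col (flip true w) e₁ e₀) (same false w z e₀ q))

-- The half `b` is intact, so every surviving vertex of the other half has its neighbour there and
-- shares its colour.
half-empty-constant : ∀ {m} {D q : 𝔽₂^ (suc m) → Bool} b → Colouring D q →
  (∀ y → D (b ∷ y) ≡ false) → Constant (half b D) (half b q) → Constant D q
half-empty-constant {D = D} {q} b col e same y z p r =
    trans (project b e y p) (trans (same (tl y) (tl z) (e _) (e _)) (sym (project b e z r)))
  where
  tl : ∀ {k} → 𝔽₂^ (suc k) → 𝔽₂^ k
  tl (_ ∷ v) = v
  project : ∀ b → (∀ y → D (b ∷ y) ≡ false) → ∀ y → D y ≡ false → q y ≡ q (b ∷ tl y)
  project false e (false ∷ y) p = refl
  project false e (true ∷ y) p = col (flip true y) p (e y)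
  project true e (false ∷ y) p = col (flip false y) p (e y)
  project true e (true ∷ y) p = refl

empty-constant : ∀ {m} {D q : 𝔽₂^ m → Bool} → Colouring D q → (∀ y → D y ≡ false) → Constant D q
empty-constant {zero} col e [] [] _ _ = refl
empty-constant {suc m} col e =
    half-empty-constant false col (λ y → e _) (empty-constant (half-colouring false col) (λ y → e _))

n<2^n : ∀ n → n < 2 ^ n
n<2^n zero = s≤s z≤n
n<2^n (suc n) = subst (suc n <_) (sym (2^suc n)) (+-mono-≤-< (≤-trans (s≤s z≤n) (n<2^n n)) (n<2^n n))

-- The m-cube is m-connected.
cube-connected : ∀ {m} {D q : 𝔽₂^ m → Bool} → Colouring D q → # D < m → Constant D q
cube-connected {suc m} {D} {q} col h with # (half false D) <? m | # (half true D) <? m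
... | yes h₀ | yes h₁ =
  -- Both halves are connected, and at most m < 2 ^ m deletions cannot hit all 2 ^ m edges between
  -- them.
  let w , e = #<⇒∃ (λ y → D (false ∷ y) ∨ D (true ∷ y))
                (≤-<-trans (≤-trans (#-∨ (half false D) (half true D)) (≤-pred h)) (n<2^n m))
      e₀ , e₁ = ∨-false e
  in halves-constant col
       (λ { false → cube-connected (half-colouring false col) h₀
          ; true → cube-connected (half-colouring true col) h₁ })
       w e₀ e₁
-- All deletions, at most m, lie in the first half, so the second is intact.
... | no h₀ | _ = half-empty-constant true col e (empty-constant (half-colouring true col) e)
  where
  e = #≡0⇒ (half true D) (n≤0⇒n≡0 (+-cancelˡ-≤ m _ 0
        (≤-trans (+-monoˡ-≤ _ (≮⇒≥ h₀)) (≤-trans (≤-pred h) (≤-reflexive (sym (+-identityʳ m)))))))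
... | yes _ | no h₁ = half-empty-constant false col e (empty-constant (half-colouring false col) e)
  where
  e = #≡0⇒ (half false D) (n≤0⇒n≡0 (+-cancelʳ-≤ m _ 0
        (≤-trans (+-monoʳ-≤ (# (half false D)) (≮⇒≥ h₁)) (≤-pred h))))

Antipodal : ∀ {m} → (D q : 𝔽₂^ m → Bool) → Set
Antipodal D q = ∀ y → D y ≡ false → D (y ⊕ 1v) ≡ false → q (y ⊕ 1v) ≡ not (q y)

free-antipodes : ∀ {m} (D : 𝔽₂^ m → Bool) → # D + # D < 2 ^ m → ∃ λ y → D y ≡ false × D (y ⊕ 1v) ≡ false
free-antipodes D h = let y , e = #<⇒∃ (λ y → D y ∨ D (y ⊕ 1v))
                           (≤-<-trans (≤-trans (#-∨ D _) (≤-reflexive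
                               (cong (λ t → # D + t) (#-shift 1v D)))) h)
                     in y , ∨-false e

-- Fewer deletions leave the cube connected, hence the colouring constant, and also spare some pair
-- of antipodes, whose colours would have to differ.
antipodal-cut : ∀ {m} {D q : 𝔽₂^ (suc m) → Bool} → Colouring D q → Antipodal D q → suc m ≤ # D
antipodal-cut {m} {D} {q} col anti with # D <? suc m
... | no h = ≮⇒≥ h
... | yes h = ⊥-elim (not-¬ refl (trans (sym (cube-connected col h _ _ e₁ e₀)) (anti y e₀ e₁)))
  where
  fa = free-antipodes D (subst (# D + # D <_) (sym (2^suc m))
         (+-mono-≤-< (<⇒≤ (≤-<-trans (≤-pred h) (n<2^n m))) (≤-<-trans (≤-pred h) (n<2^n m))))
  y = proj₁ fa
  e₀ = proj₁ (proj₂ fa)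
  e₁ = proj₂ (proj₂ fa)

-- This is where the dimension 5 in `antipodal-cut⁺` comes from: 7 + j deletions must spare two
-- antipodal edges among the 2 ^ (4 + j) edges between the halves, and 14 < 16 starts the induction.
double-<-2^ : ∀ j → (7 + j) + (7 + j) < 2 ^ (4 + j)
double-<-2^ zero = m≤m+n 15 1
double-<-2^ (suc j) = begin-strict
  (8 + j) + (8 + j)                       ≡⟨ cong suc (+-suc (7 + j) (7 + j)) ⟩
  2 + ((7 + j) + (7 + j))
    ≤⟨ +-monoˡ-≤ ((7 + j) + (7 + j)) {2} {(7 + j) + (7 + j)} (s≤s (s≤s z≤n)) ⟩
  ((7 + j) + (7 + j)) + ((7 + j) + (7 + j)) <⟨ +-mono-< (double-<-2^ j) (double-<-2^ j) ⟩
  2 ^ (4 + j) + 2 ^ (4 + j)               ≡⟨ sym (2^suc (4 + j)) ⟩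
  2 ^ (5 + j)                             ∎
  where open ≤-Reasoning

-- With m + 2 deleted vertices one half of the cube is still connected, and more than half of the
-- edges between the two halves survive.
antipodal-cut⁺ : ∀ {j} {D q : 𝔽₂^ (5 + j) → Bool} → Colouring D q → Antipodal D q → 8 + j ≤ # D
antipodal-cut⁺ {j} {D} {q} col anti with # D <? 8 + j
... | no h = ≮⇒≥ h
... | yes h = ⊥-elim (contradict (m+n<o+p _ _ (4 + j) (4 + j) (≤-trans h small)))
  where
  small : 8 + j ≤ (4 + j) + (4 + j)
  small = begin
    8 + j               ≤⟨ +-monoʳ-≤ 8 (m≤m+n j j) ⟩
    (4 + 4) + (j + j)   ≡⟨ +-interchange 4 4 j j ⟩
    (4 + j) + (4 + j)   ∎
    where open ≤-Reasoning
  C : 𝔽₂^ (4 + j) → Bool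
  C y = D (false ∷ y) ∨ D (true ∷ y)
  #C≤ : # C ≤ 7 + j
  #C≤ = ≤-trans (#-∨ (half false D) (half true D)) (≤-pred h)
  fa = free-antipodes C (≤-<-trans (+-mono-≤ #C≤ #C≤) (double-<-2^ j))
  y = proj₁ fa
  free : ∀ b z → C z ≡ false → D (b ∷ z) ≡ false
  free false z e = proj₁ (∨-false e)
  free true z e = proj₂ (∨-false e)
  e₀ : ∀ b → D (b ∷ y) ≡ false
  e₀ b = free b y (proj₁ (proj₂ fa))
  e₁ : ∀ b → D (b ∷ (y ⊕ 1v)) ≡ false
  e₁ b = free b (y ⊕ 1v) (proj₂ (proj₂ fa))
  -- In a connected half, `y` and `y ⊕ 1v` have the same colour; the intact edge at `y ⊕ 1v` carries
  -- it to the antipode of `b ∷ y`, which needs the other colour.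
  clash : ∀ b → # (half b D) < 4 + j → ⊥
  clash b hb = not-¬ refl (trans (trans
    (cube-connected (half-colouring b col) hb y (y ⊕ 1v) (e₀ b) (e₁ b))
    (trans (col (flip b (y ⊕ 1v)) (e₁ b) (e₁ (not b))) (cong (λ c → q (c ∷ (y ⊕ 1v))) (not≡xor b))))
    (anti (b ∷ y) (e₀ b) (subst (λ c → D (c ∷ (y ⊕ 1v)) ≡ false) (not≡xor b) (e₁ (not b)))))
    where
    not≡xor : ∀ b → not b ≡ b xor true
    not≡xor false = refl
    not≡xor true = refl
  contradict : # (half false D) < 4 + j ⊎ # (half true D) < 4 + j → ⊥
  contradict (inj₁ h₀) = clash false h₀
  contradict (inj₂ h₁) = clash true h₁

-- Exhaustive search and Hamming distance

search : ∀ {n} (P : 𝔽₂^ n → Bool) → (∃ λ x → P x ≡ true) ⊎ (∀ x → P x ≡ false)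
search {zero} P with P [] in eq
... | true = inj₁ ([] , eq)
... | false = inj₂ (λ { [] → eq })
search {suc n} P with search (half false P) | search (half true P)
... | inj₁ (x , e) | _ = inj₁ (false ∷ x , e)
... | inj₂ _ | inj₁ (x , e) = inj₁ (true ∷ x , e)
... | inj₂ e₀ | inj₂ e₁ = inj₂ (λ { (false ∷ x) → e₀ x ; (true ∷ x) → e₁ x })

#-empty : ∀ {n} (P : 𝔽₂^ n → Bool) → (∀ x → P x ≡ false) → # P ≡ 0
#-empty {n} P e = trans (∑-cong (λ x → cong [_] (e x))) (trans (∑-const {n} 0) (*-zeroʳ (2 ^ n)))

Distinct-pair : ∀ {n} → (𝔽₂^ n → Bool) → Set
Distinct-pair P = ∃ λ x → ∃ λ y → P x ≡ true × P y ≡ true × ¬ x ≡ y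

#≤1⊎distinct : ∀ {n} (P : 𝔽₂^ n → Bool) → # P ≤ 1 ⊎ Distinct-pair P
#≤1⊎distinct {zero} P with P []
... | true = inj₁ ≤-refl
... | false = inj₁ z≤n
#≤1⊎distinct {suc n} P with search (half false P) | search (half true P)
... | inj₁ (x , e) | inj₁ (y , e′) = inj₂ (false ∷ x , true ∷ y , e , e′ , λ ())
... | inj₂ e | _ with #≤1⊎distinct (half true P)
...   | inj₁ h = inj₁ (≤-trans (≤-reflexive (cong (_+ # (half true P)) (#-empty (half false P) e))) h)
...   | inj₂ (x , y , p , q , x≢y) = inj₂ (true ∷ x , true ∷ y , p , q , λ { refl → x≢y refl })
#≤1⊎distinct {suc n} P | inj₁ _ | inj₂ e with #≤1⊎distinct (half false P)
...   | inj₁ h = inj₁ (≤-trans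
    (≤-reflexive (trans (cong (λ t → # (half false P) + t) (#-empty (half true P) e))
    (+-identityʳ _))) h)
...   | inj₂ (x , y , p , q , x≢y) = inj₂ (false ∷ x , false ∷ y , p , q , λ { refl → x≢y refl })

#-subsingleton : ∀ {n} (P : 𝔽₂^ n → Bool) → (∀ x y → P x ≡ true → P y ≡ true → x ≡ y) → # P ≤ 1
#-subsingleton P u with #≤1⊎distinct P
... | inj₁ h = h
... | inj₂ (x , y , p , q , x≢y) = ⊥-elim (x≢y (u x y p q))

dist : ∀ {n} → 𝔽₂^ n → 𝔽₂^ n → ℕ
dist [] [] = 0
dist (a ∷ x) (b ∷ y) = [ a xor b ] + dist x y

dist≡0⇒≡ : ∀ {n} (x y : 𝔽₂^ n) → dist x y ≡ 0 → x ≡ y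
dist≡0⇒≡ [] [] _ = refl
dist≡0⇒≡ (false ∷ x) (false ∷ y) h = cong (false ∷_) (dist≡0⇒≡ x y h)
dist≡0⇒≡ (true ∷ x) (true ∷ y) h = cong (true ∷_) (dist≡0⇒≡ x y h)

dist≤n : ∀ {n} (x y : 𝔽₂^ n) → dist x y ≤ n
dist≤n [] [] = z≤n
dist≤n (a ∷ x) (b ∷ y) = +-mono-≤ (≤1 (a xor b)) (dist≤n x y)
  where
  ≤1 : ∀ b → [ b ] ≤ 1
  ≤1 false = z≤n
  ≤1 true = ≤-refl

-- If the first coordinates agree, a common neighbour shares them, as otherwise it would equal both
-- vertices in the remaining coordinates. If they differ, each half holds at most one common
-- neighbour.
common-neighbours : ∀ {n} (x x′ : 𝔽₂^ n) → ¬ x ≡ x′ → (P : 𝔽₂^ n → Bool) →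
  (∀ y → P y ≡ true → dist x y ≡ 1 × dist x′ y ≡ 1) → # P ≤ 2
common-neighbours [] [] x≢x′ P h = ⊥-elim (x≢x′ refl)
common-neighbours (a ∷ x) (b ∷ x′) x≢x′ P h = cases a b x≢x′ h
  where
  unique : ∀ (w : 𝔽₂^ _) (Q : 𝔽₂^ _ → Bool) → (∀ y → Q y ≡ true → dist w y ≡ 0) → # Q ≤ 1
  unique w Q e = #-subsingleton Q (λ y z p q →
    trans (sym (dist≡0⇒≡ w y (e y p))) (dist≡0⇒≡ w z (e z q)))
  none : ∀ (Q : 𝔽₂^ _ → Bool) → ¬ x ≡ x′ → (∀ y → Q y ≡ true → dist x y ≡ 0 × dist x′ y ≡ 0) → # Q ≡ 0
  none Q x≢ e = #-empty Q λ y → ¬-not λ p →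
    x≢ (trans (dist≡0⇒≡ x y (proj₁ (e y p))) (sym (dist≡0⇒≡ x′ y (proj₂ (e y p)))))
  sucs : ∀ {i j} → suc i ≡ 1 × suc j ≡ 1 → i ≡ 0 × j ≡ 0
  sucs (refl , refl) = refl , refl
  cases : ∀ a b → ¬ (a ∷ x) ≡ (b ∷ x′) →
          (∀ y → P y ≡ true → dist (a ∷ x) y ≡ 1 × dist (b ∷ x′) y ≡ 1) → # P ≤ 2
  cases false false n h = ≤-trans
      (≤-reflexive (trans (cong (λ t → # (half false P) + t)
      (none (half true P) (λ e → n (cong (false ∷_) e)) (λ y p → sucs (h _ p)))) (+-identityʳ _)))
    (common-neighbours x x′ (λ e → n (cong (false ∷_) e)) (half false P) (λ y → h _))
  cases true true n h = ≤-trans (≤-reflexive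
      (cong (_+ # (half true P)) (none (half false P) (λ e → n (cong (true ∷_) e))
      (λ y p → sucs (h _ p)))))
    (common-neighbours x x′ (λ e → n (cong (true ∷_) e)) (half true P) (λ y → h _))
  cases false true n h = +-mono-≤ (unique x′ (half false P) (λ y p → suc-injective (proj₂ (h _ p))))
                                  (unique x (half true P) (λ y p → suc-injective (proj₁ (h _ p))))
  cases true false n h = +-mono-≤ (unique x (half false P) (λ y p → suc-injective (proj₁ (h _ p))))
                                  (unique x′ (half true P) (λ y p → suc-injective (proj₂ (h _ p))))

-- Split by the first coordinate. If one half has at most one point, induction bounds the other. If
-- both have two, the tails in each half are common neighbours of two tails from the other half, so
-- each half has at most 2 points, and two tails at distance 2 force n ≥ 2.
equidistant-2 : ∀ {n} (P : 𝔽₂^ n → Bool) →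
  (∀ x y → P x ≡ true → P y ≡ true → dist x y ≡ 0 ⊎ dist x y ≡ 2) → # P ≤ suc n
equidistant-2 {zero} P h = #-subsingleton P (λ { [] [] _ _ → refl })
equidistant-2 {suc n} P h with #≤1⊎distinct (half false P) | #≤1⊎distinct (half true P)
... | inj₁ h₀ | _ = +-mono-≤ h₀ (equidistant-2 (half true P) (λ x y → h _ _))
... | inj₂ _ | inj₁ h₁ = ≤-trans (+-mono-≤ (equidistant-2 (half false P) (λ x y → h _ _)) h₁)
    (≤-reflexive (+-comm (suc n) 1))
... | inj₂ (x , x′ , p , p′ , x≢x′) | inj₂ (y , y′ , q , q′ , y≢y′) =
  ≤-trans (+-mono-≤ (common-neighbours y y′ y≢y′ (half false P) (λ z r → one (h _ _ q r) , one (h _ _ q′ r)))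
                    (common-neighbours x x′ x≢x′ (half true P) (λ z r → one (h _ _ p r) , one (h _ _ p′ r))))
          (s≤s (s≤s (two≤n (h _ _ p p′))))
  where
  one : ∀ {i} → suc i ≡ 0 ⊎ suc i ≡ 2 → i ≡ 1
  one (inj₂ refl) = refl
  two≤n : dist x x′ ≡ 0 ⊎ dist x x′ ≡ 2 → 2 ≤ n
  two≤n (inj₁ e) = ⊥-elim (x≢x′ (dist≡0⇒≡ x x′ e))
  two≤n (inj₂ e) = ≤-trans (≤-reflexive (sym e)) (dist≤n x x′)

-- Membership and parity

_∈_ : ∀ {n} → 𝔽₂^ n → (𝔽₂^ n → Bool) → Set
x ∈ P = P x ≡ true

infix 4 _∈_

odd : ℕ → Bool
odd zero = false
odd (suc n) = not (odd n)

odd-+ : ∀ a b → odd (a + b) ≡ odd a xor odd b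
odd-+ zero b = refl
odd-+ (suc a) b = trans (cong not (odd-+ a b)) (not-distribˡ-xor (odd a) (odd b))

par : ∀ {n} → 𝔽₂^ n → Bool
par x = 1v · x

par-1v : ∀ n → par (1v {n}) ≡ odd n
par-1v zero = refl
par-1v (suc n) = cong not (par-1v n)

odd-dist : ∀ {n} (x y : 𝔽₂^ n) → odd (dist x y) ≡ par x xor par y
odd-dist [] [] = refl
odd-dist (false ∷ x) (false ∷ y) = odd-dist x y
odd-dist (false ∷ x) (true ∷ y) = trans (cong not (odd-dist x y)) (not-distribʳ-xor (par x) (par y))
odd-dist (true ∷ x) (false ∷ y) = trans (cong not (odd-dist x y)) (not-distribˡ-xor (par x) (par y))
odd-dist (true ∷ x) (true ∷ y) = trans (odd-dist x y) (lem (par x) (par y))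
  where
  lem : ∀ p q → p xor q ≡ not p xor not q
  lem false false = refl
  lem false true = refl
  lem true false = refl
  lem true true = refl

-- Adding `v` exchanges the hyperplane and its complement.
#-balanced : ∀ {n} (f v : 𝔽₂^ n) → f · v ≡ true → # (λ x → not (f · x)) + # (λ x → not (f · x)) ≡ 2 ^ n
#-balanced f v e = trans (cong (_+ # (λ x → not (f · x))) (trans (sym (#-shift v (λ x → not (f · x))))
    (∑-cong (λ x → cong [_] (trans (cong not (trans (·-distribˡ-⊕ f x v) (cong ((f · x) xor_) e)))
       (flip-xor (f · x))))))) (#-not (λ x → f · x))
  where
  flip-xor : ∀ b → not (b xor true) ≡ b
  flip-xor false = refl
  flip-xor true = refl

#-even : ∀ n → # (λ (z : 𝔽₂^ (suc n)) → not (par z)) ≡ 2 ^ n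
#-even n = *-cancelˡ-≡ _ _ 2 (trans (trans (cong (λ t → e + t) (+-identityʳ e))
    (#-balanced {suc n} 1v (true ∷ 0v) (cong not (·-zeroʳ (1v {n}))))) refl)
  where
  e = # (λ (z : 𝔽₂^ (suc n)) → not (par z))

[]-∧ : ∀ p q → [ p ∧ q ] ≡ [ p ] * [ q ]
[]-∧ false q = refl
[]-∧ true q = sym (+-identityʳ [ q ])

∑-translates-∧ : ∀ {m n} (p : 𝔽₂^ m → Bool) (φ : 𝔽₂^ m → 𝔽₂^ n) (P : 𝔽₂^ n → Bool) →
                 ∑ (λ u → # (λ y → p y ∧ P (u ⊕ φ y))) ≡ # p * # P
∑-translates-∧ p φ P = trans (∑-swap (λ u y → [ p y ∧ P (u ⊕ φ y) ]))
  (trans (∑-cong (λ y → trans (∑-cong (λ u → []-∧ (p y) (P (u ⊕ φ y))))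
            (trans (∑-*ˡ [ p y ] (λ u → [ P (u ⊕ φ y) ]))
                (trans (cong ([ p y ] *_) (#-shift (φ y) P)) (*-comm [ p y ] (# P))))))
         (trans (∑-*ˡ (# P) (λ y → [ p y ])) (*-comm (# P) (# p))))

-- Odd circuits

agreement : ∀ {k n} → Mat k n → 𝔽₂^ k → 𝔽₂^ k → List (𝔽₂^ n)
agreement [] [] [] = []
agreement (r ∷ c) (a ∷ z) (b ∷ z′) = if a xor b then agreement c z z′ else (r ∷ agreement c z z′)

agreement-All : ∀ {k n} {P : 𝔽₂^ n → Set} (c : Mat k n) z z′ → V.All P c → All P (agreement c z z′)
agreement-All [] [] [] V.[] = []
agreement-All (r ∷ c) (a ∷ z) (b ∷ z′) (p V.∷ ps) with a xor b
... | false = p ∷ agreement-All c z z′ ps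
... | true = agreement-All c z z′ ps

agreement-length : ∀ {k n} (c : Mat k n) z z′ → length (agreement c z z′) + dist z z′ ≡ k
agreement-length [] [] [] = refl
agreement-length (r ∷ c) (a ∷ z) (b ∷ z′) with a xor b
... | false = cong suc (agreement-length c z z′)
... | true = trans (+-suc _ _) (cong suc (agreement-length c z z′))

-- A row on which `z` and `z′` differ enters once through the two combinations; one on which they
-- agree cancels there and is supplied by `agreement`.
agreement-sum : ∀ {k n} (c : Mat k n) z z′ →
  (rowComb c z ⊕ rowComb c z′) ⊕ vsum (agreement c z z′) ≡ rowComb c 1v
agreement-sum [] [] [] = trans (⊕-identityʳ _) (⊕-identityʳ _)
agreement-sum (r ∷ c) (a ∷ z) (b ∷ z′) = lem a b (agreement-sum c z z′)
  where
  s = rowComb c z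
  s′ = rowComb c z′
  t = vsum (agreement c z z′)
  ρ = r ∷ s ∷ s′ ∷ t ∷ []
  lem : ∀ a b → (s ⊕ s′) ⊕ t ≡ rowComb c 1v →
        (((if a then r else 0v) ⊕ s) ⊕ ((if b then r else 0v) ⊕ s′)) ⊕ vsum
            (if a xor b then agreement c z z′ else (r ∷ agreement c z z′))
        ≡ r ⊕ rowComb c 1v
  lem false false e = trans (solve ρ (((:0 :+ var 1F) :+ (:0 :+ var 2F)) :+ (var 0F :+ var 3F))
      (var 0F :+ ((var 1F :+ var 2F) :+ var 3F)) refl) (cong (r ⊕_) e)
  lem false true e = trans (solve ρ (((:0 :+ var 1F) :+ (var 0F :+ var 2F)) :+ var 3F)
      (var 0F :+ ((var 1F :+ var 2F) :+ var 3F)) refl) (cong (r ⊕_) e)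
  lem true false e = trans (solve ρ (((var 0F :+ var 1F) :+ (:0 :+ var 2F)) :+ var 3F)
      (var 0F :+ ((var 1F :+ var 2F) :+ var 3F)) refl) (cong (r ⊕_) e)
  lem true true e = trans (solve ρ (((var 0F :+ var 1F) :+ (var 0F :+ var 2F)) :+ (var 0F :+ var 3F))
      (var 0F :+ ((var 1F :+ var 2F) :+ var 3F)) refl) (cong (r ⊕_) e)

-- Closed lists of odd length, in which repetitions and smaller dependencies may occur. Minimality
-- is imposed on the length where it is used.
OddCircuit : ∀ {n} → (𝔽₂^ n → Bool) → List (𝔽₂^ n) → Set
OddCircuit A L = All (_∈ A) L × odd (length L) ≡ true × vsum L ≡ 0v

-- Of sum-freeness only this is kept: no two elements of `B` differ by an element of `A`. It covers
-- both the two sides of a hyperplane and the case `A` = `B`.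
module _ {n} (A B : 𝔽₂^ n → Bool) (disj : ∀ {a b} → a ∈ A → b ∈ B → b ⊕ a ∈ B → ⊥) where

  -- The vectors a, l, d₁, …, d_m form an odd circuit, and D and q are the omitted vertices and the
  -- colouring of the m-cube that B induces on the translate u + ⟨a, d₁, …, d_m⟩.
  module Circuit {m} (a l : 𝔽₂^ n) (d : Mat m n) (a∈A : a ∈ A) (l∈A : l ∈ A) (d∈A : V.All (_∈ A) d)
                 (odd-m : odd m ≡ true) (sum-zero : a ⊕ (l ⊕ rowComb d 1v) ≡ 0v) where

    module _ (u : 𝔽₂^ n) where
      -- A vertex `y` stands for two points that differ by `a`, of which at most one is in `B`.
      -- Along an edge between surviving vertices membership switches from one point to the other;
      -- adding the parity turns this into a constant colour.
      lo hi D q : 𝔽₂^ m → Bool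
      lo y = B (u ⊕ rowComb d y)
      hi y = B ((u ⊕ a) ⊕ rowComb d y)
      D y = not (lo y ∨ hi y)
      q y = hi y xor par y

      some : ∀ y → D y ≡ false → lo y ∨ hi y ≡ true
      some y e = trans (sym (not-involutive _)) (cong not e)

      clash : ∀ {s t x} → x ∈ A → t ≡ s ⊕ x → B s ≡ true → B t ≡ true → ⊥
      clash x∈A e p r = disj x∈A p (trans (cong B (sym e)) r)

      adj-sum : ∀ {k} {c : Mat k n} → V.All (_∈ A) c → ∀ {y z} → Adj y z → ∃ λ x →
          x ∈ A × rowComb c z ≡ rowComb c y ⊕ x
      adj-sum {c = r ∷ c} (p V.∷ ps) (flip false y) =
          r , p , solve (r ∷ rowComb c y ∷ []) (var 0F :+ var 1F) ((:0 :+ var 1F) :+ var 0F) refl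
      adj-sum {c = r ∷ c} (p V.∷ ps) (flip true y) =
          r , p , solve (r ∷ rowComb c y ∷ []) (:0 :+ var 1F) ((var 0F :+ var 1F) :+ var 0F) refl
      adj-sum {c = r ∷ c} (p V.∷ ps) (step b adj) with adj-sum ps adj
      ... | x , x∈A , e = x , x∈A , trans (cong (_ ⊕_) e) (sym (⊕-assoc _ _ x))

      adj-par : ∀ {k} {y z : 𝔽₂^ k} → Adj y z → par z ≡ not (par y)
      adj-par (flip false y) = refl
      adj-par (flip true y) = sym (not-involutive _)
      adj-par (step false adj) = adj-par adj
      adj-par (step true adj) = cong not (adj-par adj)

      differ : ∀ p p′ r r′ → p ∨ p′ ≡ true → r ∨ r′ ≡ true → (p ≡ true → r ≡ true → ⊥) →
               (p′ ≡ true → r′ ≡ true → ⊥) → p′ ≡ not r′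
      differ p true r false _ _ _ _ = refl
      differ p true r true _ _ _ h = ⊥-elim (h refl refl)
      differ true false true r′ _ _ h _ = ⊥-elim (h refl refl)
      differ true false false true _ _ _ _ = refl

      same : ∀ p p′ r r′ → p ∨ p′ ≡ true → r ∨ r′ ≡ true → (p ≡ true → r′ ≡ true → ⊥) →
             (p′ ≡ true → r ≡ true → ⊥) → p′ ≡ r′
      same true false r false _ _ _ _ = refl
      same true false r true _ _ h _ = ⊥-elim (h refl refl)
      same p true true r′ _ _ _ h = ⊥-elim (h refl refl)
      same p true false true _ _ _ _ = refl

      colouring : Colouring D q
      colouring {y} {z} adj ey ez with adj-sum d∈A adj
      ... | x , x∈A , e = trans (cong₂ _xor_ (differ (lo y) (hi y) (lo z) (hi z) (some y ey) (some z ez)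
              (clash x∈A (shifted u)) (clash x∈A (shifted (u ⊕ a))))
                  (trans (sym (not-involutive (par y))) (cong not (sym (adj-par adj)))))
              (trans (sym (not-distribˡ-xor (hi z) _))
                  (trans (cong not (sym (not-distribʳ-xor (hi z) (par z)))) (not-involutive _)))
        where
        shifted : ∀ w → w ⊕ rowComb d z ≡ (w ⊕ rowComb d y) ⊕ x
        shifted w = trans (cong (w ⊕_) e) (sym (⊕-assoc w _ x))

      -- The circuit relation gives `rowComb d 1v` = `a ⊕ l`. Up to `l`, the antipode has the same
      -- two points in the other order, so `hi` is preserved, while the parity flips because m is
      -- odd.
      antipodal : Antipodal D q
      antipodal y ey ez = trans (cong₂ _xor_ (sym agree) par-flip) (sym (not-distribʳ-xor (hi y) (par y)))
        where
        z = y ⊕ 1v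
        par-flip : par z ≡ not (par y)
        par-flip = trans (·-distribˡ-⊕ 1v y 1v)
            (trans (cong (par y xor_) (trans (par-1v m) odd-m)) (xor-comm (par y) true))
        σ1 : rowComb d 1v ≡ a ⊕ l
        σ1 = trans (solve (a ∷ l ∷ rowComb d 1v ∷ []) (var 2F)
            ((var 0F :+ var 1F) :+ (var 0F :+ (var 1F :+ var 2F))) refl)
                   (trans (cong ((a ⊕ l) ⊕_) sum-zero) (⊕-identityʳ _))
        σz : rowComb d z ≡ rowComb d y ⊕ (a ⊕ l)
        σz = trans (rowComb-⊕ d y 1v) (cong (rowComb d y ⊕_) σ1)
        ρ = u ∷ a ∷ l ∷ rowComb d y ∷ []
        lo-z : u ⊕ rowComb d z ≡ ((u ⊕ a) ⊕ rowComb d y) ⊕ l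
        lo-z = trans (cong (u ⊕_) σz) (solve ρ (var 0F :+ (var 3F :+ (var 1F :+ var 2F)))
            (((var 0F :+ var 1F) :+ var 3F) :+ var 2F) refl)
        hi-z : (u ⊕ a) ⊕ rowComb d z ≡ (u ⊕ rowComb d y) ⊕ l
        hi-z = trans (cong ((u ⊕ a) ⊕_) σz)
            (solve ρ ((var 0F :+ var 1F) :+ (var 3F :+ (var 1F :+ var 2F)))
            ((var 0F :+ var 3F) :+ var 2F) refl)
        agree : hi y ≡ hi z
        agree = same (lo y) (hi y) (lo z) (hi z) (some y ey) (some z ez) (clash l∈A hi-z) (clash l∈A lo-z)

      fibre : # lo + # hi + # D ≤ 2 ^ m
      fibre = begin
        # lo + # hi + # D                             ≡⟨ cong (_+ # D) (sym (∑-+ (λ y → [ lo y ]) _)) ⟩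
        ∑ (λ y → [ lo y ] + [ hi y ]) + # D           ≡⟨ sym (∑-+ (λ y → [ lo y ] + [ hi y ]) _) ⟩
        ∑ (λ y → [ lo y ] + [ hi y ] + [ D y ])
          ≤⟨ ∑-mono (λ y → at-most-one (lo y) (hi y) (clash a∈A (hi-lo y))) ⟩
        ∑ {m} (λ y → 1)                                   ≡⟨ trans (∑-const {m} 1) (*-identityʳ (2 ^ m)) ⟩
        2 ^ m                                         ∎
        where
        open ≤-Reasoning
        at-most-one : ∀ p r → (p ≡ true → r ≡ true → ⊥) → [ p ] + [ r ] + [ not (p ∨ r) ] ≤ 1
        at-most-one true true h = ⊥-elim (h refl refl)
        at-most-one true false h = ≤-refl
        at-most-one false true h = ≤-refl
        at-most-one false false h = ≤-refl
        hi-lo : ∀ y → (u ⊕ a) ⊕ rowComb d y ≡ (u ⊕ rowComb d y) ⊕ a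
        hi-lo y = solve (u ∷ a ∷ rowComb d y ∷ []) ((var 0F :+ var 1F) :+ var 2F)
            ((var 0F :+ var 2F) :+ var 1F) refl

    -- Sum `fibre` over all `u`: every element of `B` is counted 2 ^ m times as a low point and as
    -- often as a high one.
    #B-bound : ∀ K → (∀ u → K ≤ # (D u)) → 2 ^ m * # B + 2 ^ m * # B + 2 ^ n * K ≤ 2 ^ n * 2 ^ m
    #B-bound K h = begin
      2 ^ m * # B + 2 ^ m * # B + 2 ^ n * K
        ≡⟨ sym (cong₂ _+_ (cong₂ _+_ (∑-translates (rowComb d) B)
              (trans (∑-shift a (λ u → # (lo u))) (∑-translates (rowComb d) B))) (∑-const {n} K)) ⟩
      ∑ (λ u → # (lo u)) + ∑ (λ u → # (hi u)) + ∑ {n} (λ u → K)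
        ≡⟨ cong (_+ ∑ {n} (λ u → K)) (sym (∑-+ (λ u → # (lo u)) _)) ⟩
      ∑ (λ u → # (lo u) + # (hi u)) + ∑ {n} (λ u → K)
        ≡⟨ sym (∑-+ (λ u → # (lo u) + # (hi u)) _) ⟩
      ∑ (λ u → # (lo u) + # (hi u) + K)
        ≤⟨ ∑-mono (λ u → ≤-trans (+-monoʳ-≤ _ (h u)) (fibre u)) ⟩
      ∑ {n} (λ u → 2 ^ m)
        ≡⟨ ∑-const {n} (2 ^ m) ⟩
      2 ^ n * 2 ^ m ∎
      where open ≤-Reasoning

    -- If there are no shorter odd circuits, two coefficient vectors of the same parity whose
    -- combinations lie in a common translate of A disagree in at most two places.
    #A-bound : (∀ L → length L < 2 + m → ¬ OddCircuit A L) → 2 ^ (1 + m) * # A ≤ 2 ^ n * (3 + m)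
    #A-bound shorter = begin
      2 ^ (1 + m) * # A                                    ≡⟨ cong (_* # A) (sym (#-even (1 + m))) ⟩
      # (λ (z : 𝔽₂^ (2 + m)) → not (par z)) * # A
        ≡⟨ sym (∑-translates-∧ (λ z → not (par z)) (rowComb c) A) ⟩
      ∑ (λ u → # (λ z → not (par z) ∧ A (u ⊕ rowComb c z)))
                                                           ≤⟨ ∑-mono (λ u → equidistant-2 _ (close u)) ⟩
      ∑ {n} (λ u → 3 + m)                                  ≡⟨ ∑-const {n} (3 + m) ⟩
      2 ^ n * (3 + m)                                      ∎
      where
      open ≤-Reasoning
      c : Mat (2 + m) n
      c = a ∷ l ∷ d
      ∧-true : ∀ {p r} → p ∧ r ≡ true → p ≡ true × r ≡ true
      ∧-true {true} {true} _ = refl , refl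
      not-true : ∀ {p} → not p ≡ true → p ≡ false
      not-true {false} _ = refl
      close : ∀ u z z′ → not (par z) ∧ A (u ⊕ rowComb c z) ≡ true →
          not (par z′) ∧ A (u ⊕ rowComb c z′) ≡ true →
              dist z z′ ≡ 0 ⊎ dist z z′ ≡ 2
      close u z z′ h h′ = cases (dist z z′) refl
        where
        even-dist : odd (dist z z′) ≡ false
        even-dist = trans (odd-dist z z′)
            (cong₂ _xor_ (not-true (proj₁ (∧-true {not (par z)} h)))
            (not-true (proj₁ (∧-true {not (par z′)} h′))))
        x = u ⊕ rowComb c z
        x′ = u ⊕ rowComb c z′
        rest = agreement c z z′
        cases : ∀ e → dist z z′ ≡ e → dist z z′ ≡ 0 ⊎ dist z z′ ≡ 2
        cases 0 eq = inj₁ eq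
        cases 1 eq = ⊥-elim (not-¬ (cong odd eq) even-dist)
        cases 2 eq = inj₂ eq
        -- At distance 3 or more, `x`, `x′` and the agreeing rows would form a shorter circuit, of
        -- odd length because the distance is even.
        cases (suc (suc (suc e))) eq = ⊥-elim (shorter (x ∷ x′ ∷ rest) short
            ( proj₂ (∧-true {not (par z)} h) ∷ proj₂ (∧-true {not (par z′)} h′) ∷ agreement-All c z
                z′ (a∈A V.∷ l∈A V.∷ d∈A)
            , trans (not-involutive _) odd-rest
            , trans (solve (u ∷ rowComb c z ∷ rowComb c z′ ∷ vsum rest ∷ [])
                       ((var 0F :+ var 1F) :+ ((var 0F :+ var 2F) :+ var 3F))
                           ((var 1F :+ var 2F) :+ var 3F) refl)
                    (trans (agreement-sum c z z′) sum-zero)))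
          where
          len : length rest + (3 + e) ≡ 2 + m
          len = trans (cong (λ t → length rest + t) (sym eq)) (agreement-length c z z′)
          short : 2 + length rest < 2 + m
          short = subst (suc (2 + length rest) ≤_) (trans (+-comm (3 + e) _) len)
              (≤-trans (≤-reflexive (+-comm 3 (length rest)))
                    (≤-trans (+-monoʳ-≤ (length rest) (m≤m+n 3 e)) (≤-reflexive (+-comm (length rest) _))))
          odd-rest : odd (length rest) ≡ true
          odd-rest = trans (sym (trans (odd-+ (length rest) (3 + e))
              (trans (cong (odd (length rest) xor_) (trans (cong odd (sym eq)) even-dist))
              (xor-comm _ false))))
                           (trans (cong odd len) (trans (not-involutive _) odd-m))

  -- The same `K` bounds `a` and measures the loss for `b`, so the two cancel.
  pair-bound : ∀ M K N a b → 0 < M → 2 * M * a ≤ N * K → M * b + M * b + N * K ≤ N * M → 2 * (a + b) ≤ N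
  pair-bound M@(suc _) K N a b _ hA hB = *-cancelˡ-≤ M (begin
    M * (2 * (a + b))
      ≡⟨ ring 3 (λ M a b → M :* (con 2 :* (a ⊞ b)) := M :* b ⊞ M :* b ⊞ con 2 :* M :* a) refl M a b ⟩
    M * b + M * b + 2 * M * a   ≤⟨ +-monoʳ-≤ (M * b + M * b) hA ⟩
    M * b + M * b + N * K       ≤⟨ hB ⟩
    N * M                       ≡⟨ *-comm N M ⟩
    M * N                       ∎)
    where open ≤-Reasoning

  -- For a triangle, m = 1 with one omitted vertex: `B` fills at most a quarter of the space.
  triangle-bound : ∀ N b → 2 * b + 2 * b + N * 1 ≤ N * 2 → 3 * b ≤ N
  triangle-bound N b h = ≤-trans (*-monoˡ-≤ b (m≤m+n 3 1)) (+-cancelʳ-≤ N (4 * b) N (begin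
    4 * b + N
      ≡⟨ ring 2 (λ b N → con 4 :* b ⊞ N := con 2 :* b ⊞ con 2 :* b ⊞ N :* con 1) refl b N ⟩
    2 * b + 2 * b + N * 1  ≤⟨ h ⟩
    N * 2                  ≡⟨ ring 1 (λ N → N :* con 2 := N ⊞ N) refl N ⟩
    N + N                  ∎))
    where open ≤-Reasoning

  -- For a pentagon, m = 3 with three omitted vertices: `B` fills at most 5/16 of the space, still
  -- below a third.
  pentagon-bound : ∀ N b → 8 * b + 8 * b + N * 3 ≤ N * 8 → 3 * b ≤ N
  pentagon-bound N b h = *-cancelˡ-≤ 5
      (≤-trans (≤-trans (≤-reflexive (sym (*-assoc 5 3 b))) (*-monoˡ-≤ b (m≤m+n 15 1)))
    (+-cancelʳ-≤ (3 * N) (16 * b) (5 * N) (begin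
      16 * b + 3 * N
        ≡⟨ ring 2 (λ b N → con 16 :* b ⊞ con 3 :* N := con 8 :* b ⊞ con 8 :* b ⊞ N :* con 3) refl b N
          ⟩
      8 * b + 8 * b + N * 3  ≤⟨ h ⟩
      N * 8                  ≡⟨ ring 1 (λ N → N :* con 8 := con 5 :* N ⊞ con 3 :* N) refl N ⟩
      5 * N + 3 * N          ∎)))
    where open ≤-Reasoning

  -- Take an odd circuit of minimal length 2 + m. Lengths 3 and 5 contradict the density of `B`
  -- alone; from length 7 on, minimality bounds `A` too, and the two sets together are too small.
  no-odd-circuit : 2 ^ n < 2 * (# A + # B) → 2 ^ n < 3 * # B → ∀ L → ¬ OddCircuit A L
  no-odd-circuit dense denseB L = below (suc (length L)) L ≤-refl
    where
    open Circuit using (#B-bound; #A-bound; colouring; antipodal)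
    B-element : ∃ (_∈ B)
    B-element with search B
    ... | inj₁ x = x
    ... | inj₂ e = ⊥-elim (n≮0 (subst (2 ^ n <_) (cong (3 *_) (#-empty B e)) denseB))
    listAll : ∀ {L} → All (_∈ A) L → Σ (Mat (length L) n) λ d → V.All (_∈ A) d × vsum L ≡ rowComb d 1v
    listAll [] = [] , V.[] , refl
    listAll {x ∷ L} (p ∷ ps) with listAll ps
    ... | d , qs , e = x ∷ d , p V.∷ qs , cong (x ⊕_) e
    circuit : ∀ m a l (d : Mat m n) (p : a ∈ A) (p′ : l ∈ A) (ps : V.All (_∈ A) d) (o : odd m ≡ true)
              (z : a ⊕ (l ⊕ rowComb d 1v) ≡ 0v) → (∀ L → length L < 2 + m → ¬ OddCircuit A L) → ⊥
    circuit 0 a l d p p′ ps () z sh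
    circuit 1 a l d p p′ ps o z sh = <⇒≱ denseB (triangle-bound (2 ^ n) (# B)
      (#B-bound a l d p p′ ps o z 1 (λ u →
          antipodal-cut (colouring a l d p p′ ps o z u) (antipodal a l d p p′ ps o z u))))
    circuit 2 a l d p p′ ps () z sh
    circuit 3 a l d p p′ ps o z sh = <⇒≱ denseB (pentagon-bound (2 ^ n) (# B)
      (#B-bound a l d p p′ ps o z 3 (λ u →
          antipodal-cut (colouring a l d p p′ ps o z u) (antipodal a l d p p′ ps o z u))))
    circuit 4 a l d p p′ ps () z sh
    -- With m = 5 + j, the 8 + j omitted vertices are 3 + m in number, exactly the constant in
    -- `#A-bound`.
    circuit m@(suc (suc (suc (suc (suc j))))) a l d p p′ ps o z sh = <⇒≱ dense
      (pair-bound (2 ^ m) (3 + m) (2 ^ n) (# A) (# B) (≤-trans (s≤s z≤n) (n<2^n m))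
          (#A-bound a l d p p′ ps o z sh)
        (#B-bound a l d p p′ ps o z (3 + m)
            (λ u → antipodal-cut⁺ (colouring a l d p p′ ps o z u) (antipodal a l d p p′ ps o z u))))
    below : ∀ k L → length L < k → ¬ OddCircuit A L
    -- A circuit of length 1 is the zero vector, by which any element of `B` differs from itself.
    below (suc k) (a ∷ []) h (p ∷ [] , _ , e) =
      disj p (proj₂ B-element) (trans
          (cong B (trans (cong (proj₁ B-element ⊕_) (trans (sym (⊕-identityʳ a)) e))
          (⊕-identityʳ _))) (proj₂ B-element))
    below (suc k) (a ∷ l ∷ L) h (p ∷ p′ ∷ ps , o , e) with listAll ps
    ... | d , qs , e′ = circuit (length L) a l d p p′ qs (trans (sym (not-involutive _)) o)
      (trans (cong (λ t → a ⊕ (l ⊕ t)) (sym e′)) e) (λ L′ h′ → below k L′ (≤-trans h′ (≤-pred h)))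

-- Linear systems over 𝔽₂

-- S x b ≡ true stands for the equation f · x ≡ b in the unknown f.
Equations : ℕ → Set
Equations n = 𝔽₂^ n → Bool → Bool

data Consequence {n} (S : Equations n) : 𝔽₂^ n → Bool → Set where
  nil : Consequence S 0v false
  add : ∀ {x b y c} → S x b ≡ true → Consequence S y c → Consequence S (x ⊕ y) (b xor c)

∨-true : ∀ {p q} → p ∨ q ≡ true → p ≡ true ⊎ q ≡ true
∨-true {true} e = inj₁ refl
∨-true {false} e = inj₂ e

-- Gaussian elimination on the first coordinate. If no equation involves it, it is set to `false`;
-- otherwise one such equation is the pivot and is added to all that involve it. A contradiction in
-- the smaller system is carried back as a sum of the given equations.
fredholm : ∀ {n} (S : Equations n) → (∃ λ f → ∀ x b → S x b ≡ true → f · x ≡ b) ⊎ Consequence S 0v true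
fredholm {zero} S with S [] true in eq
... | true = inj₂ (add eq nil)
... | false = inj₁ ([] , λ { [] false _ → refl ; [] true e → ⊥-elim (not-¬ eq e) })
fredholm {suc n} S with search (λ x → S (true ∷ x) true ∨ S (true ∷ x) false)
... | inj₂ none with fredholm (λ x → S (false ∷ x))
...   | inj₁ (f , h) = inj₁ (false ∷ f , λ
          { (false ∷ x) b e → h x b e
          ; (true ∷ x) true e → ⊥-elim (not-¬ e (proj₁ (∨-false (none x))))
          ; (true ∷ x) false e → ⊥-elim (not-¬ e (proj₂ (∨-false {S (true ∷ x) true} (none x)))) })
...   | inj₂ k = inj₂ (lift k)
  where
  lift : ∀ {y c} → Consequence (λ x → S (false ∷ x)) y c → Consequence S (false ∷ y) c
  lift nil = nil
  lift (add e k) = add e (lift k)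
fredholm {suc n} S | inj₁ (x₀ , e₀) = eliminate (pivot (∨-true e₀))
  where
  pivot : S (true ∷ x₀) true ≡ true ⊎ S (true ∷ x₀) false ≡ true → ∃ λ b → S (true ∷ x₀) b ≡ true
  pivot (inj₁ e) = true , e
  pivot (inj₂ e) = false , e
  eliminate : (∃ λ b → S (true ∷ x₀) b ≡ true) →
              (∃ λ f → ∀ x b → S x b ≡ true → f · x ≡ b) ⊎ Consequence S 0v true
  eliminate (b₀ , p) with fredholm (λ x b → S (false ∷ x) b ∨ S (true ∷ (x ⊕ x₀)) (b xor b₀))
  -- The first coordinate of the solution is the value that satisfies the pivot equation.
  ... | inj₁ (f , h) = inj₁ ((b₀ xor (f · x₀)) ∷ f , solves)
    where
    solves : ∀ x b → S x b ≡ true → ((b₀ xor (f · x₀)) ∷ f) · x ≡ b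
    solves (false ∷ x) b e = trans (cong (_xor (f · x)) (∧-zeroʳ (b₀ xor (f · x₀))))
                                   (h x b (trans (cong (_∨ S (true ∷ (x ⊕ x₀)) (b xor b₀)) e) refl))
    solves (true ∷ x) b e = trans (cong (λ t → ((b₀ xor (f · x₀)) ∧ true) xor t)
        (trans (cong (f ·_) (sym shift))
        (trans (·-distribˡ-⊕ f (x ⊕ x₀) x₀) (cong (_xor (f · x₀)) (h (x ⊕ x₀) (b xor b₀) holds)))))
                                  (lem b b₀ (f · x₀))
      where
      shift : (x ⊕ x₀) ⊕ x₀ ≡ x
      shift = solve (x ∷ x₀ ∷ []) ((var 0F :+ var 1F) :+ var 1F) (var 0F) refl
      xor-shift : ∀ b b₀ → (b xor b₀) xor b₀ ≡ b
      xor-shift b b₀ = trans (xor-assoc b b₀ b₀) (trans (cong (b xor_) (xor-same b₀)) (xor-identityʳ b))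
      holds : S (false ∷ (x ⊕ x₀)) (b xor b₀) ∨ S (true ∷ ((x ⊕ x₀) ⊕ x₀)) ((b xor b₀) xor b₀) ≡ true
      holds = trans (cong (S (false ∷ (x ⊕ x₀)) (b xor b₀) ∨_)
          (trans (cong₂ (λ y c → S (true ∷ y) c) shift (xor-shift b b₀)) e)) (∨-zeroʳ _)
      lem : ∀ b b₀ s → ((b₀ xor s) ∧ true) xor ((b xor b₀) xor s) ≡ b
      lem false false false = refl
      lem false false true = refl
      lem false true false = refl
      lem false true true = refl
      lem true false false = refl
      lem true false true = refl
      lem true true false = refl
      lem true true true = refl
  ... | inj₂ k = inj₂ (lift k)
    where
    lift : ∀ {y c} → Consequence (λ x b → S (false ∷ x) b ∨ S (true ∷ (x ⊕ x₀)) (b xor b₀)) y c →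
        Consequence S (false ∷ y) c
    lift nil = nil
    lift (add {x} {b} {y} {c} e k) with ∨-true e
    ... | inj₁ e′ = add e′ (lift k)
    ... | inj₂ e′ = subst₂ (λ z d → Consequence S (false ∷ z) d)
            (solve (x ∷ x₀ ∷ y ∷ []) ((var 0F :+ var 1F) :+ (var 1F :+ var 2F)) (var 0F :+ var 2F) refl)
            (cancel b b₀ c) (add e′ (add p (lift k)))
      where
      cancel : ∀ b b₀ c → (b xor b₀) xor (b₀ xor c) ≡ b xor c
      cancel b b₀ c = trans (xor-assoc b b₀ _)
          (cong (b xor_) (trans (sym (xor-assoc b₀ b₀ c)) (cong (_xor c) (xor-same b₀))))

-- Otherwise the system f · x = 1 on `A` has 0 = 1 as a sum of its equations. The right sides show
-- that an odd number is used, so the left sides form an odd circuit.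
affine : ∀ {n} (A : 𝔽₂^ n → Bool) → (∀ L → ¬ OddCircuit A L) → ∃ λ f → ∀ x → x ∈ A → f · x ≡ true
affine {n} A none with fredholm (λ x b → A x ∧ b)
... | inj₁ (f , h) = f , λ x x∈A → h x true (cong (_∧ true) x∈A)
... | inj₂ k = let L , a , o , s = circuit k in ⊥-elim (none L (a , o , s))
  where
  ∧-true : ∀ {p b} → p ∧ b ≡ true → p ≡ true × b ≡ true
  ∧-true {true} {true} _ = refl , refl
  circuit : ∀ {y c} → Consequence (λ x b → A x ∧ b) y c → ∃ λ L →
      All (_∈ A) L × odd (length L) ≡ c × vsum L ≡ y
  circuit nil = [] , [] , refl , refl
  circuit (add {x} {b} e k) with ∧-true {A x} e | circuit k
  ... | x∈A , refl | L , a , o , s = x ∷ L , x∈A ∷ a , cong not o , cong (x ⊕_) s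

-- The Fourier (Walsh–Hadamard) transform

∑ℤ : ∀ {n} → (𝔽₂^ n → ℤ) → ℤ
∑ℤ {zero} f = f []
∑ℤ {suc n} f = ∑ℤ (half false f) ℤ.+ ∑ℤ (half true f)

∑ℤ-cong : ∀ {n} {f g : 𝔽₂^ n → ℤ} → (∀ x → f x ≡ g x) → ∑ℤ f ≡ ∑ℤ g
∑ℤ-cong {zero} h = h []
∑ℤ-cong {suc n} h = cong₂ ℤ._+_ (∑ℤ-cong (λ x → h (false ∷ x))) (∑ℤ-cong (λ x → h (true ∷ x)))

∑ℤ-linear : ∀ {n} a b (f g : 𝔽₂^ n → ℤ) → ∑ℤ (λ x → a ℤ.* f x ℤ.+ b ℤ.* g x) ≡ a ℤ.* ∑ℤ f ℤ.+ b ℤ.* ∑ℤ g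
∑ℤ-linear {zero} a b f g = refl
∑ℤ-linear {suc n} a b f g = trans
    (cong₂ ℤ._+_ (∑ℤ-linear a b (half false f) (half false g))
    (∑ℤ-linear a b (half true f) (half true g)))
  (ℤS.solve 6 (λ a b p q r s → (a ℤS.:* p ℤS.:+ b ℤS.:* q) ℤS.:+ (a ℤS.:* r ℤS.:+ b ℤS.:* s) ℤS.:= a
      ℤS.:* (p ℤS.:+ r) ℤS.:+ b ℤS.:* (q ℤS.:+ s)) refl a b _ _ _ _)

∑ℤ-+ : ∀ {n} (f : 𝔽₂^ n → ℕ) → ∑ℤ (λ x → + f x) ≡ + ∑ f
∑ℤ-+ {zero} f = refl
∑ℤ-+ {suc n} f = cong₂ ℤ._+_ (∑ℤ-+ (half false f)) (∑ℤ-+ (half true f))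

∑ℤ-≥0 : ∀ {n} (f : 𝔽₂^ n → ℤ) → (∀ x → 0ℤ ℤ.≤ f x) → 0ℤ ℤ.≤ ∑ℤ f
∑ℤ-≥0 {zero} f h = h []
∑ℤ-≥0 {suc n} f h = ℤₚ.+-mono-≤ (∑ℤ-≥0 (half false f) (λ x → h _)) (∑ℤ-≥0 (half true f) (λ x → h _))

∑ℤ-≥-at-0 : ∀ {n} (f : 𝔽₂^ n → ℤ) → (∀ x → ¬ x ≡ 0v → 0ℤ ℤ.≤ f x) → f 0v ℤ.≤ ∑ℤ f
∑ℤ-≥-at-0 {zero} f h = ℤₚ.≤-refl
∑ℤ-≥-at-0 {suc n} f h = ℤₚ.≤-trans (ℤₚ.≤-reflexive (sym (ℤₚ.+-identityʳ _)))
  (ℤₚ.+-mono-≤ (∑ℤ-≥-at-0 (half false f) (λ x x≢0 → h (false ∷ x) (λ { refl → x≢0 refl })))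
               (∑ℤ-≥0 (half true f) (λ x → h (true ∷ x) (λ ()))))

sign : Bool → ℤ → ℤ
sign false z = z
sign true z = ℤ.- z

-- The sum of (-1)^(γ · x) g(x) over x, written with the recursion of the fast transform so that its
-- identities follow by induction on n.
hat : ∀ {n} → (𝔽₂^ n → ℤ) → 𝔽₂^ n → ℤ
hat g [] = g []
hat g (b ∷ γ) = hat (half false g) γ ℤ.+ sign b (hat (half true g) γ)

-- The value at x is the sum of g(y) h(y + x) over y, split by the first coordinate of y.
conv : ∀ {n} → (𝔽₂^ n → ℤ) → (𝔽₂^ n → ℤ) → 𝔽₂^ n → ℤ
conv g h [] = g [] ℤ.* h []
conv g h (b ∷ x) = conv (half false g) (half b h) x ℤ.+ conv (half true g) (half (not b) h) x

hat-+ : ∀ {n} (g h : 𝔽₂^ n → ℤ) γ → hat (λ x → g x ℤ.+ h x) γ ≡ hat g γ ℤ.+ hat h γ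
hat-+ g h [] = refl
hat-+ g h (b ∷ γ) = trans (cong₂ (λ p q → p ℤ.+ sign b q) (hat-+ (half false g) (half false h) γ)
    (hat-+ (half true g) (half true h) γ))
    (lem b (hat (half false g) γ) (hat (half false h) γ) (hat (half true g) γ) (hat (half true h) γ))
  where
  lem : ∀ b p q r s → (p ℤ.+ q) ℤ.+ sign b (r ℤ.+ s) ≡ (p ℤ.+ sign b r) ℤ.+ (q ℤ.+ sign b s)
  lem false = ℤS.solve 4 (λ p q r s → (p ℤS.:+ q) ℤS.:+ (r ℤS.:+ s) ℤS.:= (p ℤS.:+ r) ℤS.:+ (q ℤS.:+ s)) refl
  lem true = ℤS.solve 4 (λ p q r s →
      (p ℤS.:+ q) ℤS.:+ (ℤS.:- (r ℤS.:+ s)) ℤS.:= (p ℤS.:+ (ℤS.:- r)) ℤS.:+ (q ℤS.:+ (ℤS.:- s))) refl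

hat-conv : ∀ {n} (g h : 𝔽₂^ n → ℤ) γ → hat (conv g h) γ ≡ hat g γ ℤ.* hat h γ
hat-conv g h [] = refl
hat-conv g h (b ∷ γ) = trans (cong₂ (λ p q → p ℤ.+ sign b q)
    (trans (hat-+ (conv (half false g) (half false h)) (conv (half true g) (half true h)) γ)
        (cong₂ ℤ._+_ (hat-conv (half false g) (half false h) γ)
        (hat-conv (half true g) (half true h) γ)))
    (trans (hat-+ (conv (half false g) (half true h)) (conv (half true g) (half false h)) γ)
        (cong₂ ℤ._+_ (hat-conv (half false g) (half true h) γ)
        (hat-conv (half true g) (half false h) γ))))
  (lem b (hat (half false g) γ) (hat (half true g) γ) (hat (half false h) γ) (hat (half true h) γ))
  where
  lem : ∀ b p q r s → (p ℤ.* r ℤ.+ q ℤ.* s) ℤ.+ sign b (p ℤ.* s ℤ.+ q ℤ.* r) ≡ (p ℤ.+ sign b q) ℤ.*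
      (r ℤ.+ sign b s)
  lem false = ℤS.solve 4 (λ p q r s →
      (p ℤS.:* r ℤS.:+ q ℤS.:* s) ℤS.:+ (p ℤS.:* s ℤS.:+ q ℤS.:* r) ℤS.:= (p ℤS.:+ q) ℤS.:*
      (r ℤS.:+ s)) refl
  lem true = ℤS.solve 4 (λ p q r s →
      (p ℤS.:* r ℤS.:+ q ℤS.:* s) ℤS.:+ (ℤS.:- (p ℤS.:* s ℤS.:+ q ℤS.:* r)) ℤS.:= (p ℤS.:+ (ℤS.:- q))
      ℤS.:* (r ℤS.:+ (ℤS.:- s))) refl

-- Each coordinate contributes a factor 2, through (p + q)(r + s) + (p - q)(r - s) = 2 (p r + q s).
parseval : ∀ {n} (g h : 𝔽₂^ n → ℤ) → ∑ℤ (λ γ → hat g γ ℤ.* hat h γ) ≡ + (2 ^ n) ℤ.* ∑ℤ (λ x → g x ℤ.* h x)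
parseval {zero} g h = sym (ℤₚ.*-identityˡ _)
parseval {suc n} g h = begin
  ∑ℤ (λ γ → (g₀ γ ℤ.+ g₁ γ) ℤ.* (h₀ γ ℤ.+ h₁ γ)) ℤ.+ ∑ℤ (λ γ → (g₀ γ ℤ.+ ℤ.- g₁ γ) ℤ.* (h₀ γ ℤ.+ ℤ.- h₁ γ))
    ≡⟨ sym (trans (∑ℤ-linear 1ℤ 1ℤ f₊ f₋) (cong₂ ℤ._+_ (ℤₚ.*-identityˡ (∑ℤ f₊)) (ℤₚ.*-identityˡ (∑ℤ f₋)))) ⟩
  ∑ℤ (λ γ → 1ℤ ℤ.* ((g₀ γ ℤ.+ g₁ γ) ℤ.* (h₀ γ ℤ.+ h₁ γ)) ℤ.+ 1ℤ ℤ.*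
      ((g₀ γ ℤ.+ ℤ.- g₁ γ) ℤ.* (h₀ γ ℤ.+ ℤ.- h₁ γ)))
    ≡⟨ ∑ℤ-cong (λ γ → lem (g₀ γ) (g₁ γ) (h₀ γ) (h₁ γ)) ⟩
  ∑ℤ (λ γ → + 2 ℤ.* (g₀ γ ℤ.* h₀ γ) ℤ.+ + 2 ℤ.* (g₁ γ ℤ.* h₁ γ))
    ≡⟨ ∑ℤ-linear (+ 2) (+ 2) (λ γ → g₀ γ ℤ.* h₀ γ) (λ γ → g₁ γ ℤ.* h₁ γ) ⟩
  + 2 ℤ.* ∑ℤ (λ γ → g₀ γ ℤ.* h₀ γ) ℤ.+ + 2 ℤ.* ∑ℤ (λ γ → g₁ γ ℤ.* h₁ γ)
    ≡⟨ cong₂ (λ p q → + 2 ℤ.* p ℤ.+ + 2 ℤ.* q) (parseval (half false g) (half false h))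
        (parseval (half true g) (half true h)) ⟩
  + 2 ℤ.* (+ (2 ^ n) ℤ.* p₀) ℤ.+ + 2 ℤ.* (+ (2 ^ n) ℤ.* p₁)
    ≡⟨ ℤS.solve 3 (λ N p q → ℤS.con (+ 2) ℤS.:* (N ℤS.:* p) ℤS.:+ ℤS.con (+ 2) ℤS.:* (N ℤS.:* q)
        ℤS.:= (ℤS.con (+ 2) ℤS.:* N) ℤS.:* (p ℤS.:+ q)) refl (+ (2 ^ n)) p₀ p₁ ⟩
  (+ 2 ℤ.* + (2 ^ n)) ℤ.* (p₀ ℤ.+ p₁)
    ≡⟨ cong (ℤ._* (p₀ ℤ.+ p₁)) (sym (ℤₚ.pos-* 2 (2 ^ n))) ⟩
  + (2 ^ suc n) ℤ.* (p₀ ℤ.+ p₁) ∎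
  where
  open ≡-Reasoning
  g₀ g₁ h₀ h₁ : 𝔽₂^ n → ℤ
  g₀ = hat (half false g)
  g₁ = hat (half true g)
  h₀ = hat (half false h)
  h₁ = hat (half true h)
  f₊ f₋ : 𝔽₂^ n → ℤ
  f₊ γ = (g₀ γ ℤ.+ g₁ γ) ℤ.* (h₀ γ ℤ.+ h₁ γ)
  f₋ γ = (g₀ γ ℤ.+ ℤ.- g₁ γ) ℤ.* (h₀ γ ℤ.+ ℤ.- h₁ γ)
  p₀ p₁ : ℤ
  p₀ = ∑ℤ (λ x → g (false ∷ x) ℤ.* h (false ∷ x))
  p₁ = ∑ℤ (λ x → g (true ∷ x) ℤ.* h (true ∷ x))
  lem : ∀ p q r s → 1ℤ ℤ.* ((p ℤ.+ q) ℤ.* (r ℤ.+ s)) ℤ.+ 1ℤ ℤ.* ((p ℤ.+ ℤ.- q) ℤ.* (r ℤ.+ ℤ.- s)) ≡ +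
      2 ℤ.* (p ℤ.* r) ℤ.+ + 2 ℤ.* (q ℤ.* s)
  lem = ℤS.solve 4 (λ p q r s → ℤS.con 1ℤ ℤS.:* ((p ℤS.:+ q) ℤS.:* (r ℤS.:+ s)) ℤS.:+ ℤS.con 1ℤ ℤS.:*
      ((p ℤS.:+ (ℤS.:- q)) ℤS.:* (r ℤS.:+ (ℤS.:- s))) ℤS.:= ℤS.con (+ 2) ℤS.:* (p ℤS.:* r) ℤS.:+
      ℤS.con (+ 2) ℤS.:* (q ℤS.:* s)) refl

conv-zero : ∀ {n} (g h : 𝔽₂^ n → ℤ) x → (∀ y → g y ℤ.* h (y ⊕ x) ≡ 0ℤ) → conv g h x ≡ 0ℤ
conv-zero g h [] z = z []
conv-zero g h (b ∷ x) z = cong₂ ℤ._+_ (conv-zero (half false g) (half b h) x (λ y → z (false ∷ y)))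
                                      (conv-zero (half true g) (half (not b) h) x (λ y → z (true ∷ y)))

ind : ∀ {n} → (𝔽₂^ n → Bool) → 𝔽₂^ n → ℤ
ind P x = + [ P x ]

hat-ind : ∀ {n} (P : 𝔽₂^ n → Bool) γ → hat (ind P) γ ≡ + # P ℤ.- + 2 ℤ.* + # (λ x → P x ∧ γ · x)
hat-ind P [] with P []
... | true = refl
... | false = refl
hat-ind {suc n} P (false ∷ γ) = trans (cong₂ ℤ._+_ (hat-ind (half false P) γ) (hat-ind (half true P) γ))
  (ℤS.solve 4 (λ p q r s → (p ℤS.:+ (ℤS.:- (ℤS.con (+ 2) ℤS.:* r))) ℤS.:+
      (q ℤS.:+ (ℤS.:- (ℤS.con (+ 2) ℤS.:* s))) ℤS.:= (p ℤS.:+ q) ℤS.:+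
      (ℤS.:- (ℤS.con (+ 2) ℤS.:* (r ℤS.:+ s)))) refl (+ # (half false P)) (+ # (half true P))
      (+ # (λ x → P (false ∷ x) ∧ γ · x)) (+ # (λ x → P (true ∷ x) ∧ γ · x)))
hat-ind {suc n} P (true ∷ γ) =
    trans (cong₂ (λ p q → p ℤ.+ ℤ.- q) (hat-ind (half false P) γ) (hat-ind (half true P) γ))
  (trans (cong (λ t → (+ # (half false P) ℤ.- + 2 ℤ.* + r₀) ℤ.+ ℤ.- (t ℤ.- + 2 ℤ.* + s)) split)
  (trans (ℤS.solve 4 (λ p r s s′ →
      (p ℤS.:+ (ℤS.:- (ℤS.con (+ 2) ℤS.:* r))) ℤS.:+
      (ℤS.:- ((s ℤS.:+ s′) ℤS.:+ (ℤS.:- (ℤS.con (+ 2) ℤS.:* s)))) ℤS.:= (p ℤS.:+ (s ℤS.:+ s′)) ℤS.:+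
      (ℤS.:- (ℤS.con (+ 2) ℤS.:* (r ℤS.:+ s′)))) refl (+ # (half false P)) (+ r₀) (+ s) (+ s′))
    (cong (λ t → (+ # (half false P) ℤ.+ t) ℤ.- + 2 ℤ.* (+ r₀ ℤ.+ + s′)) (sym split))))
  where
  r₀ = # (λ x → P (false ∷ x) ∧ γ · x)
  s = # (λ x → P (true ∷ x) ∧ γ · x)
  s′ = # (λ x → P (true ∷ x) ∧ not (γ · x))
  by-cases : ∀ p q → [ p ] ≡ [ p ∧ q ] + [ p ∧ not q ]
  by-cases false q = refl
  by-cases true false = refl
  by-cases true true = refl
  split : + # (half true P) ≡ + s ℤ.+ + s′
  split = cong +_ (trans (∑-cong (λ x → by-cases (P (true ∷ x)) (γ · x)))
      (∑-+ (λ x → [ P (true ∷ x) ∧ γ · x ]) _))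

hat-0v : ∀ {n} (g : 𝔽₂^ n → ℤ) → hat g 0v ≡ ∑ℤ g
hat-0v {zero} g = refl
hat-0v {suc n} g = cong₂ ℤ._+_ (hat-0v (half false g)) (hat-0v (half true g))

SumFree : ∀ {n} → (𝔽₂^ n → Bool) → Set
SumFree E = ∀ {x y} → x ∈ E → y ∈ E → y ⊕ x ∈ E → ⊥

-- Σ ê(γ)² (3 ê(γ) − 3|E| + 2ⁿ) is evaluated by Parseval; the cubes contribute nothing as E is sum-free.
biased-hyperplane : ∀ {n} (E : 𝔽₂^ n → Bool) → SumFree E → 2 ^ n < 4 * # E →
  ∃ λ γ → 2 ^ n < 6 * # (λ x → E x ∧ γ · x)
biased-hyperplane {n} E sum-free dense with search (λ γ → 2 ^ n <ᵇ 6 * # (λ x → E x ∧ γ · x))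
... | inj₁ (γ , h) = γ , <ᵇ⇒< (2 ^ n) _ (subst T (sym h) _)
... | inj₂ none = ⊥-elim (<⇒≱ dense (ℤₚ.drop‿+≤+ final))
  where
  e = # E
  N = 2 ^ n
  b : 𝔽₂^ n → ℕ
  b γ = # (λ x → E x ∧ γ · x)
  small : ∀ γ → 6 * b γ ≤ N
  small γ = ≮⇒≥ (λ h → subst T (none γ) (<⇒<ᵇ h))
  g ê : 𝔽₂^ n → ℤ
  g = ind E
  ê = hat g
  -- By `hat-ind` the last factor is 3 ê γ - 3 e + N. As no hyperplane is biased, every `w γ` is
  -- nonnegative.
  w : 𝔽₂^ n → ℤ
  w γ = (ê γ ℤ.* ê γ) ℤ.* (+ N ℤ.- + (6 * b γ))
  square-≥0 : ∀ z → 0ℤ ℤ.≤ z ℤ.* z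
  square-≥0 (+ m) = subst (0ℤ ℤ.≤_) (ℤₚ.pos-* m m) (ℤ.+≤+ z≤n)
  square-≥0 ℤ.-[1+ m ] = ℤ.+≤+ z≤n
  *-≥0 : ∀ {y z} → 0ℤ ℤ.≤ y → 0ℤ ℤ.≤ z → 0ℤ ℤ.≤ y ℤ.* z
  *-≥0 {+ p} {+ q} _ _ = subst (0ℤ ℤ.≤_) (ℤₚ.pos-* p q) (ℤ.+≤+ z≤n)
  w-≥0 : ∀ γ → 0ℤ ℤ.≤ w γ
  w-≥0 γ = *-≥0 (square-≥0 (ê γ)) (ℤₚ.i≤j⇒0≤j-i (ℤ.+≤+ (small γ)))
  w-expand : ∀ γ → w γ ≡ + 3 ℤ.* (hat (conv g g) γ ℤ.* ê γ) ℤ.+ (+ N ℤ.- + 3 ℤ.* + e) ℤ.* (ê γ ℤ.* ê γ)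
  w-expand γ = trans (cong (λ t → (ê γ ℤ.* ê γ) ℤ.* (+ N ℤ.- t)) (ℤₚ.pos-* 6 (b γ)))
    (trans (lem (ê γ) (+ e) (+ b γ) (+ N) (hat-ind E γ))
    (cong (λ t → + 3 ℤ.* (t ℤ.* ê γ) ℤ.+ (+ N ℤ.- + 3 ℤ.* + e) ℤ.* (ê γ ℤ.* ê γ)) (sym (hat-conv g g γ))))
    where
    lem : ∀ h e b N → h ≡ e ℤ.- + 2 ℤ.* b → (h ℤ.* h) ℤ.* (N ℤ.- + 6 ℤ.* b) ≡
          + 3 ℤ.* ((h ℤ.* h) ℤ.* h) ℤ.+ (N ℤ.- + 3 ℤ.* e) ℤ.* (h ℤ.* h)
    lem h e b N refl = ℤS.solve 3 (λ e b N → let h = e ℤS.:+ (ℤS.:- (ℤS.con (+ 2) ℤS.:* b)) in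
      (h ℤS.:* h) ℤS.:* (N ℤS.:+ (ℤS.:- (ℤS.con (+ 6) ℤS.:* b))) ℤS.:=
      ℤS.con (+ 3) ℤS.:* ((h ℤS.:* h) ℤS.:* h) ℤS.:+ (N ℤS.:+ (ℤS.:- (ℤS.con (+ 3) ℤS.:* e))) ℤS.:*
          (h ℤS.:* h)) refl e b N
  cubes : ∑ℤ (λ γ → hat (conv g g) γ ℤ.* ê γ) ≡ 0ℤ
  cubes = trans (parseval (conv g g) g)
      (trans (cong (+ N ℤ.*_) (trans (∑ℤ-cong zero-term)
      (trans (∑ℤ-+ {n} (λ _ → 0)) (cong +_ (trans (∑-const {n} 0) (*-zeroʳ N)))))) (ℤₚ.*-zeroʳ (+ N)))
    where
    zero-term : ∀ x → conv g g x ℤ.* g x ≡ 0ℤ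
    zero-term x with E x in ex
    ... | false = ℤₚ.*-zeroʳ (conv g g x)
    ... | true = cong (ℤ._* + 1) (conv-zero g g x term)
      where
      term : ∀ y → g y ℤ.* g (y ⊕ x) ≡ 0ℤ
      term y with E y in ey
      ... | false = refl
      ... | true with E (y ⊕ x) in eyx
      ...   | false = refl
      ...   | true = ⊥-elim (sum-free ex ey eyx)
  squares : ∑ℤ (λ γ → ê γ ℤ.* ê γ) ≡ + N ℤ.* + e
  squares = trans (parseval g g) (cong (+ N ℤ.*_) (trans (∑ℤ-cong idem) (∑ℤ-+ (λ x → [ E x ]))))
    where
    idem : ∀ x → g x ℤ.* g x ≡ g x
    idem x with E x
    ... | true = refl
    ... | false = refl
  total : ∑ℤ w ≡ (+ N ℤ.- + 3 ℤ.* + e) ℤ.* (+ N ℤ.* + e)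
  total = trans (∑ℤ-cong w-expand)
      (trans (∑ℤ-linear (+ 3) (+ N ℤ.- + 3 ℤ.* + e) (λ γ → hat (conv g g) γ ℤ.* ê γ)
      (λ γ → ê γ ℤ.* ê γ))
    (trans (cong₂ (λ p q → + 3 ℤ.* p ℤ.+ (+ N ℤ.- + 3 ℤ.* + e) ℤ.* q) cubes squares)
        (ℤₚ.+-identityˡ ((+ N ℤ.- + 3 ℤ.* + e) ℤ.* (+ N ℤ.* + e)))))
  at-0 : w 0v ≡ + e ℤ.* (+ N ℤ.* + e)
  at-0 = trans (cong₂ (λ h t → (h ℤ.* h) ℤ.* (+ N ℤ.- + (6 * t)))
      (trans (hat-0v g) (∑ℤ-+ (λ x → [ E x ]))) b0)
    (ℤS.solve 2 (λ e N → (e ℤS.:* e) ℤS.:* (N ℤS.:+ (ℤS.:- ℤS.con (+ 0))) ℤS.:= e ℤS.:* (N ℤS.:* e))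
        refl (+ e) (+ N))
    where
    0v· : ∀ {k} (x : 𝔽₂^ k) → 0v · x ≡ false
    0v· [] = refl
    0v· (c ∷ x) = 0v· x
    b0 : b 0v ≡ 0
    b0 = #-empty _ (λ x → trans (cong (E x ∧_) (0v· x)) (∧-zeroʳ (E x)))
  instance
    Ne-pos : ℤ.Positive (+ N ℤ.* + e)
    Ne-pos = positive N e (≤-trans (s≤s z≤n) (n<2^n n)) (nonzero e dense)
      where
      nonzero : ∀ e → N < 4 * e → 0 < e
      nonzero zero h = ⊥-elim (n≮0 h)
      nonzero (suc e) h = s≤s z≤n
      positive : ∀ p q → 0 < p → 0 < q → ℤ.Positive (+ p ℤ.* + q)
      positive (suc p) (suc q) _ _ = _
  -- The term at 0 is e · N · e and the whole sum is (N - 3 e) · N · e; the positive factor N · e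
  -- cancels.
  key : + e ℤ.≤ + N ℤ.- + 3 ℤ.* + e
  key = ℤₚ.*-cancelʳ-≤-pos (+ e) _ (+ N ℤ.* + e) (subst₂ ℤ._≤_ at-0 total (∑ℤ-≥-at-0 w (λ γ _ → w-≥0 γ)))
  final : + (4 * e) ℤ.≤ + N
  final = subst₂ ℤ._≤_ (trans (ℤS.solve 1
      (λ e → e ℤS.:+ ℤS.con (+ 3) ℤS.:* e ℤS.:= ℤS.con (+ 4) ℤS.:* e) refl (+ e))
      (sym (ℤₚ.pos-* 4 e)))
    (ℤS.solve 2 (λ e N → (N ℤS.:+ (ℤS.:- (ℤS.con (+ 3) ℤS.:* e))) ℤS.:+ ℤS.con (+ 3) ℤS.:* e ℤS.:= N)
        refl (+ e) (+ N))
    (ℤₚ.+-monoˡ-≤ (+ 3 ℤ.* + e) key)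

-- Projection to a hyperplane

project : ∀ {n} → (γ v x : 𝔽₂^ n) → 𝔽₂^ n
project γ v x = if γ · x then x ⊕ v else x

module _ {n} (γ v : 𝔽₂^ n) (γv : γ · v ≡ true) where

  project-⊕ : ∀ x y → project γ v (x ⊕ y) ≡ project γ v x ⊕ project γ v y
  project-⊕ x y rewrite ·-distribˡ-⊕ γ x y = lem (γ · x) (γ · y)
    where
    ρ = x ∷ y ∷ v ∷ []
    lem : ∀ p q → (if p xor q then (x ⊕ y) ⊕ v else x ⊕ y) ≡ (if p then x ⊕ v else x) ⊕
        (if q then y ⊕ v else y)
    lem false false = refl
    lem false true = solve ρ ((var 0F :+ var 1F) :+ var 2F) (var 0F :+ (var 1F :+ var 2F)) refl
    lem true false = solve ρ ((var 0F :+ var 1F) :+ var 2F) ((var 0F :+ var 2F) :+ var 1F) refl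
    lem true true = solve ρ (var 0F :+ var 1F) ((var 0F :+ var 2F) :+ (var 1F :+ var 2F)) refl

  project-hyperplane : ∀ {x} → γ · x ≡ false → project γ v x ≡ x
  project-hyperplane {x} e = cong (λ b → if b then x ⊕ v else x) e

  shift-value : ∀ x → γ · (x ⊕ v) ≡ not (γ · x)
  shift-value x = trans (·-distribˡ-⊕ γ x v) (trans (cong ((γ · x) xor_) γv) (xor-comm (γ · x) true))

  γ·project : ∀ x → γ · project γ v x ≡ false
  γ·project x with γ · x in e
  ... | false = e
  ... | true = trans (shift-value x) (cong not e)

  -- Each point of the hyperplane has two preimages, itself and its translate by `v`. Sets in the
  -- hyperplane can thus be handled in the full space, where only their size doubles.
  #-project : ∀ (P : 𝔽₂^ n → Bool) → # (λ x → P (project γ v x)) ≡ 2 * # (λ x → P x ∧ not (γ · x))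
  #-project P = trans (∑-cong pointwise)
      (trans (∑-+ (λ x → [ Q x ]) _)
      (cong (λ t → # Q + t) (trans (#-shift v Q) (sym (+-identityʳ (# Q))))))
    where
    Q : 𝔽₂^ n → Bool
    Q x = P x ∧ not (γ · x)
    pointwise : ∀ x → [ P (project γ v x) ] ≡ [ Q x ] + [ Q (x ⊕ v) ]
    pointwise x rewrite shift-value x = lem (γ · x) (P x) (P (x ⊕ v))
      where
      lem : ∀ b p q → [ P (if b then x ⊕ v else x) ] ≡ [ P x ∧ not b ] + [ P (x ⊕ v) ∧ not (not b) ]
      lem true _ _ with P x | P (x ⊕ v)
      ... | true | true = refl
      ... | true | false = refl
      ... | false | true = refl
      ... | false | false = refl
      lem false _ _ with P x | P (x ⊕ v)
      ... | true | true = refl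
      ... | true | false = refl
      ... | false | true = refl
      ... | false | false = refl

∧-trueˡ : ∀ {p q} → p ∧ q ≡ true → p ≡ true
∧-trueˡ {true} _ = refl

∧-trueʳ : ∀ {p q} → p ∧ q ≡ true → q ≡ true
∧-trueʳ {true} e = e

sum-free-cover : ∀ {n} (E : 𝔽₂^ n → Bool) → SumFree E → 2 ^ n < 4 * # E →
  ∃ λ γ → ∃ λ f → ∀ x → x ∈ E → γ · x ≡ false → f · x ≡ true
sum-free-cover {n} E sum-free dense = γ , f , λ x x∈E e →
    f-one x (trans (cong E (project-hyperplane γ v γv e)) x∈E)
  where
  bias = biased-hyperplane E sum-free dense
  γ = proj₁ bias
  point : ∃ λ v → v ∈ (λ x → E x ∧ γ · x)
  point with search (λ x → E x ∧ γ · x)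
  ... | inj₁ p = p
  ... | inj₂ none = ⊥-elim (n≮0 (subst (2 ^ n <_) (cong (6 *_) (#-empty _ none)) (proj₂ bias)))
  v = proj₁ point
  γv : γ · v ≡ true
  γv = ∧-trueʳ {E v} (proj₂ point)
  -- The parts of `E` on the hyperplane and, moved into it by `v`, off it, both pulled back along
  -- the projection. As sizes double, the conditions of `no-odd-circuit` become |E| > N/4 and the
  -- bias.
  A B : 𝔽₂^ n → Bool
  A x = E (project γ v x)
  B x = E (project γ v x ⊕ v)
  disj : ∀ {a b} → a ∈ A → b ∈ B → b ⊕ a ∈ B → ⊥
  disj {a} {b} p q s = sum-free p q (trans (cong E (trans
    (solve (project γ v b ∷ project γ v a ∷ v ∷ []) ((var 0F :+ var 2F) :+ var 1F)
        ((var 0F :+ var 1F) :+ var 2F) refl)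
    (cong (_⊕ v) (sym (project-⊕ γ v γv b a))))) s)
  H̄ : 𝔽₂^ n → Bool
  H̄ x = E x ∧ γ · x
  #B : # B ≡ 2 * # H̄
  #B = trans (#-project γ v γv (λ x → E (x ⊕ v)))
      (cong (2 *_) (trans (sym (#-shift v _)) (∑-cong λ x → cong [_]
    (cong₂ _∧_ (cong E (solve (x ∷ v ∷ []) ((var 0F :+ var 1F) :+ var 1F) (var 0F) refl))
       (trans (cong not (shift-value γ v γv x)) (not-involutive _))))))
  #A+#B : # A + # B ≡ 2 * # E
  #A+#B = trans (cong₂ _+_ (#-project γ v γv E) #B)
      (trans (sym (*-distribˡ-+ 2 (# (λ x → E x ∧ not (γ · x))) (# H̄)))
    (cong (2 *_) (trans (sym (∑-+ (λ x → [ E x ∧ not (γ · x) ]) _)) (∑-cong (λ x → by-cases (E x) (γ · x))))))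
    where
    by-cases : ∀ p q → [ p ∧ not q ] + [ p ∧ q ] ≡ [ p ]
    by-cases false q = refl
    by-cases true false = refl
    by-cases true true = refl
  aff = affine A (no-odd-circuit A B disj
    (subst (2 ^ n <_) (trans (*-assoc 2 2 (# E)) (cong (2 *_) (sym #A+#B))) dense)
    (subst (2 ^ n <_) (trans (*-assoc 3 2 (# H̄)) (cong (3 *_) (sym #B))) (proj₂ bias)))
  f = proj₁ aff
  f-one = proj₂ aff

-- Flats and covers

-- If 0v ∉ E, then φ is injective and this is a copy of PG(k − 1, 2) in E.
record Flat {n} (k : ℕ) (E : 𝔽₂^ n → Bool) : Set where
  field
    φ        : 𝔽₂^ k → 𝔽₂^ n
    additive : ∀ c d → φ (c ⊕ d) ≡ φ c ⊕ φ d
    inside   : ∀ c → ¬ c ≡ 0v → φ c ∈ E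

  φ-0v : φ 0v ≡ 0v
  φ-0v = trans (trans (sym (⊕-identityʳ _)) (cong (φ 0v ⊕_) (sym (⊕-self (φ 0v)))))
    (trans (sym (⊕-assoc (φ 0v) (φ 0v) (φ 0v)))
        (trans (cong (_⊕ φ 0v) (trans (sym (additive 0v 0v)) (cong φ (⊕-identityʳ 0v))))
        (⊕-self (φ 0v))))

open Flat

flat₀ : ∀ {n} {E : 𝔽₂^ n → Bool} → Flat 0 E
flat₀ .φ _ = 0v
flat₀ .additive c d = sym (⊕-identityʳ 0v)
flat₀ .inside [] c≢0 = ⊥-elim (c≢0 refl)

extend : ∀ {n k} {E : 𝔽₂^ n → Bool} (P : Flat k E) x → (∀ c → x ⊕ φ P c ∈ E) → Flat (suc k) E
extend P x h .φ (b ∷ c) = if b then x ⊕ φ P c else φ P c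
extend P x h .additive (false ∷ c) (false ∷ d) = additive P c d
extend P x h .additive (false ∷ c) (true ∷ d) =
    trans (cong (x ⊕_) (additive P c d))
    (solve (x ∷ φ P c ∷ φ P d ∷ []) (var 0F :+ (var 1F :+ var 2F)) (var 1F :+ (var 0F :+ var 2F))
    refl)
extend P x h .additive (true ∷ c) (false ∷ d) = trans (cong (x ⊕_) (additive P c d)) (sym (⊕-assoc x _ _))
extend P x h .additive (true ∷ c) (true ∷ d) =
    trans (additive P c d) (solve (x ∷ φ P c ∷ φ P d ∷ []) (var 1F :+ var 2F)
    ((var 0F :+ var 1F) :+ (var 0F :+ var 2F)) refl)
extend P x h .inside (false ∷ c) c≢0 = inside P c (λ e → c≢0 (cong (false ∷_) e))
extend P x h .inside (true ∷ c) _ = h c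

-- For t = 4 this is the size hypothesis of the theorem, expressed through the complement.
Dense : ∀ {n} → ℕ → (𝔽₂^ n → Bool) → Set
Dense {n} t E = 2 ^ t * # (λ x → not (E x)) < 3 * 2 ^ n

-- The rows may be dependent, so the subspace avoiding E has codimension at most k.
Covered : ∀ {n} → ℕ → (𝔽₂^ n → Bool) → Set
Covered {n} k E = Σ (Mat k n) λ F → ∀ x → apply F x ≡ 0v → E x ≡ false

-- Cores of flats and descent to a hyperplane

every : ∀ {k} → (𝔽₂^ k → Bool) → Bool
every {zero} P = P []
every {suc k} P = every (half false P) ∧ every (half true P)

∧-false : ∀ {p q} → p ∧ q ≡ false → p ≡ false ⊎ q ≡ false
∧-false {false} e = inj₁ refl
∧-false {true} e = inj₂ e

every⇒ : ∀ {k} (P : 𝔽₂^ k → Bool) → every P ≡ true → ∀ c → P c ≡ true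
every⇒ P e [] = e
every⇒ P e (false ∷ c) = every⇒ (half false P) (∧-trueˡ e) c
every⇒ P e (true ∷ c) = every⇒ (half true P) (∧-trueʳ {every (half false P)} e) c

⇒every : ∀ {k} (P : 𝔽₂^ k → Bool) → (∀ c → P c ≡ true) → every P ≡ true
⇒every {zero} P h = h []
⇒every {suc k} P h = cong₂ _∧_ (⇒every (half false P) (λ c → h _)) (⇒every (half true P) (λ c → h _))

¬every⇒ : ∀ {k} (P : 𝔽₂^ k → Bool) → every P ≡ false → ∃ λ c → P c ≡ false
¬every⇒ {zero} P e = [] , e
¬every⇒ {suc k} P e with ∧-false e
... | inj₁ e₀ = let c , h = ¬every⇒ (half false P) e₀ in false ∷ c , h
... | inj₂ e₁ = let c , h = ¬every⇒ (half true P) e₁ in true ∷ c , h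

∈⇒#>0 : ∀ {n} (P : 𝔽₂^ n → Bool) {x} → x ∈ P → 0 < # P
∈⇒#>0 P {x} x∈P with # P in eq
... | zero = ⊥-elim (not-¬ x∈P (#≡0⇒ P eq x))
... | suc _ = s≤s z≤n

#>0⇒∈ : ∀ {n} (P : 𝔽₂^ n → Bool) → 0 < # P → ∃ (_∈ P)
#>0⇒∈ P h with search P
... | inj₁ x = x
... | inj₂ none = ⊥-elim (n≮0 (subst (0 <_) (#-empty P none) h))

-- The 2 ^ k translates of `P` by the values of `φ` cover `Q`.
#≤-translates : ∀ {n k} (Q P : 𝔽₂^ n → Bool) (φ : 𝔽₂^ k → 𝔽₂^ n) →
  (∀ x → x ∈ Q → ∃ λ c → x ⊕ φ c ∈ P) → # Q ≤ 2 ^ k * # P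
#≤-translates Q P φ h = ≤-trans (∑-mono pointwise) (≤-reflexive (∑-translates φ P))
  where
  pointwise : ∀ x → [ Q x ] ≤ # (λ c → P (x ⊕ φ c))
  pointwise x with Q x in eq
  ... | false = z≤n
  ... | true = ∈⇒#>0 (λ c → P (x ⊕ φ c)) (proj₂ (h x eq))

#-by-cases : ∀ {n} (P Q : 𝔽₂^ n → Bool) → # P ≡ # (λ x → P x ∧ not (Q x)) + # (λ x → P x ∧ Q x)
#-by-cases P Q = trans (∑-cong (λ x → lem (P x) (Q x))) (∑-+ (λ x → [ P x ∧ not (Q x) ]) _)
  where
  lem : ∀ p q → [ p ] ≡ [ p ∧ not q ] + [ p ∧ q ]
  lem false q = refl
  lem true false = refl
  lem true true = refl

core : ∀ {n k} {E : 𝔽₂^ n → Bool} → Flat k E → 𝔽₂^ n → Bool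
core {E = E} P x = every (λ c → E (x ⊕ φ P c))

module _ {n k} {E : 𝔽₂^ n → Bool} (P : Flat k E) (no-flat : ¬ Flat (2 + k) E) where

  -- Two elements of the core whose sum is in the core would extend the flat twice, to rank k + 2.
  core-sum-free : SumFree (core P)
  core-sum-free {x} {y} x∈ y∈ y+x∈ = no-flat (extend (extend P x (every⇒ _ x∈)) y λ
    { (false ∷ c) → every⇒ _ y∈ c
    ; (true ∷ c) → trans (cong E (sym (⊕-assoc y x (φ P c)))) (every⇒ _ y+x∈ c) })

  core-shift : ∀ {x} → x ∈ core P → ∀ c → x ⊕ φ P c ∈ core P
  core-shift {x} x∈ c = ⇒every _ λ d →
      trans (cong E (trans (⊕-assoc x _ _) (cong (x ⊕_) (sym (additive P c d)))))
                                             (every⇒ _ x∈ (c ⊕ d))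

  module _ (large : 2 ^ n < 3 * # (core P)) (dense : Dense (2 + k) E) where

    private
      -- Both sets in `no-odd-circuit` are the core, for which the second density condition implies
      -- the first.
      aff = affine (core P) (no-odd-circuit (core P) (core P) core-sum-free
        (<-≤-trans large (≤-trans (*-monoˡ-≤ (# (core P)) (m≤m+n 3 1))
           (≤-reflexive (ring 1 (λ e → con 4 :* e := con 2 :* (e ⊞ e)) refl (# (core P))))))
        large)

    ℓ v : 𝔽₂^ n
    ℓ = proj₁ aff
    v = proj₁ (#>0⇒∈ (core P) (*-cancelˡ-< 3 0 _ (≤-<-trans z≤n large)))

    ℓ-core : ∀ x → x ∈ core P → ℓ · x ≡ true
    ℓ-core = proj₂ aff

    v∈core : v ∈ core P
    v∈core = proj₂ (#>0⇒∈ (core P) (*-cancelˡ-< 3 0 _ (≤-<-trans z≤n large)))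

    ℓv : ℓ · v ≡ true
    ℓv = ℓ-core v v∈core

    -- Every translate of P in the hyperplane H and every translate outside H of a flat of rank
    -- k + 1 in E ∩ H meets the complement of E.
    hyperplane-flat-free : ¬ Flat (1 + k) (λ x → E x ∧ not (ℓ · x))
    hyperplane-flat-free R = <⇒≱ dense (begin
      -- Translates give h₀ ≤ 2 ^ k |S₀| and h₁ ≤ 2 ^ (1 + k) |S₁|. The weights 4 and 2 bring both
      -- to the factor 2 ^ (2 + k), and six half-spaces make 3 · 2 ^ n.
      3 * 2 ^ n                                         ≡⟨ cong (3 *_) (sym (#-balanced ℓ v ℓv)) ⟩
      3 * (h₀ + h₀)
        ≡⟨ ring 1 (λ h → con 3 :* (h ⊞ h) := con 4 :* h ⊞ con 2 :* h) refl h₀ ⟩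
      4 * h₀ + 2 * h₀                                   ≡⟨ cong (λ t → 4 * h₀ + 2 * t) h₀≡h₁ ⟩
      4 * h₀ + 2 * h₁
        ≤⟨ +-mono-≤ (*-monoʳ-≤ 4 (#≤-translates (λ x → not (ℓ · x)) S₀ (φ P) inner))
          (*-monoʳ-≤ 2 (#≤-translates (ℓ ·_) S₁ (φ R) outer)) ⟩
      4 * (2 ^ k * # S₀) + 2 * (2 ^ (1 + k) * # S₁)
        ≡⟨ ring 3 (λ K s t → con 4 :* (K :* s) ⊞ con 2 :* (con 2 :* K :* t) := con 2 :* (con 2 :* K)
          :* (s ⊞ t)) refl (2 ^ k) (# S₀) (# S₁) ⟩
      2 ^ (2 + k) * (# S₀ + # S₁)
        ≡⟨ cong (2 ^ (2 + k) *_) (sym (#-by-cases (λ x → not (E x)) (ℓ ·_))) ⟩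
      2 ^ (2 + k) * # (λ x → not (E x))                 ∎)
      where
      open ≤-Reasoning
      S₀ S₁ : 𝔽₂^ n → Bool
      S₀ x = not (E x) ∧ not (ℓ · x)
      S₁ x = not (E x) ∧ ℓ · x
      h₀ h₁ : ℕ
      h₀ = # (λ x → not (ℓ · x))
      h₁ = # (ℓ ·_)
      h₀≡h₁ : h₀ ≡ h₁
      h₀≡h₁ = +-cancelʳ-≡ h₀ h₀ h₁ (trans (#-balanced ℓ v ℓv) (sym (#-not (ℓ ·_))))
      -- The core contains `v` and its translates by the flat, and `ℓ` is 1 on all of them, so it
      -- vanishes on the flat.
      ℓφ : ∀ c → ℓ · φ P c ≡ false
      ℓφ c = xor-trueˡ (trans (cong (_xor (ℓ · φ P c)) (sym ℓv))
          (trans (sym (·-distribˡ-⊕ ℓ v (φ P c))) (ℓ-core _ (core-shift v∈core c))))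
        where
        xor-trueˡ : ∀ {b} → true xor b ≡ true → b ≡ false
        xor-trueˡ {false} _ = refl
      ℓψ : ∀ c → ℓ · φ R c ≡ false
      ℓψ c with ≡-dec Bool._≟_ c 0v
      ... | yes refl = trans (cong (ℓ ·_) (φ-0v R)) (·-zeroʳ ℓ)
      ... | no c≢0 = trans (sym (not-involutive _)) (cong not (∧-trueʳ {E (φ R c)} (inside R c c≢0)))
      inner : ∀ x → not (ℓ · x) ≡ true → ∃ λ c → x ⊕ φ P c ∈ S₀
      inner x e with core P x in ex
      ... | true = ⊥-elim (not-¬ e (cong not (ℓ-core x ex)))
      ... | false = let c , h = ¬every⇒ _ ex in c , cong₂ _∧_ (cong not h)
          (trans (cong not (trans (·-distribˡ-⊕ ℓ x _)
          (trans (cong ((ℓ · x) xor_) (ℓφ c)) (Bool.xor-identityʳ _)))) e)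
      outer : ∀ x → ℓ · x ≡ true → ∃ λ c → x ⊕ φ R c ∈ S₁
      outer x e with every (λ c → E (x ⊕ φ R c)) in ex
      ... | true = ⊥-elim (no-flat (extend R′ x (every⇒ (λ c → E (x ⊕ φ R c)) ex)))
        where
        R′ : Flat (1 + k) E
        R′ .φ = φ R
        R′ .additive = additive R
        R′ .inside c c≢0 = ∧-trueˡ (inside R c c≢0)
      ... | false = let c , h = ¬every⇒ (λ c → E (x ⊕ φ R c)) ex in c , cong₂ _∧_ (cong not h)
          (trans (·-distribˡ-⊕ ℓ x _) (cong₂ _xor_ e (ℓψ c)))

    -- The part of `E` in the hyperplane is pulled back to the full space. Its complement is at most
    -- twice that of `E`, which is paid for by lowering t by one, and `ℓ` joins the resulting cover
    -- as a further row.
    cover-by-hyperplane : (∀ (E′ : 𝔽₂^ n → Bool) → ¬ Flat (1 + k) E′ → Dense (1 + k) E′ →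
        ¬ ¬ Covered (1 + k) E′) →
                          ¬ ¬ Covered (2 + k) E
    cover-by-hyperplane covering not-covered =
        covering E′ flat-free dense′ (λ { (F , h) → not-covered (ℓ ∷ F , λ x e →
        trans (cong E (sym (project-hyperplane ℓ v ℓv (∷-injectiveˡ e)))) (h x (∷-injectiveʳ e))) })
      where
      E′ : 𝔽₂^ n → Bool
      E′ x = E (project ℓ v x)
      flat-free : ¬ Flat (1 + k) E′
      flat-free R = hyperplane-flat-free record
        { φ = λ c → project ℓ v (φ R c)
        ; additive = λ c d → trans (cong (project ℓ v) (additive R c d)) (project-⊕ ℓ v ℓv _ _)
        ; inside = λ c c≢0 → cong₂ _∧_ (inside R c c≢0) (cong not (γ·project ℓ v ℓv (φ R c))) }
      dense′ : Dense (1 + k) E′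
      dense′ = ≤-<-trans (begin
        2 ^ (1 + k) * # (λ x → not (E′ x))
          ≡⟨ cong (2 ^ (1 + k) *_) (#-project ℓ v ℓv (λ x → not (E x))) ⟩
        2 ^ (1 + k) * (2 * # (λ x → not (E x) ∧ not (ℓ · x)))
          ≤⟨ *-monoʳ-≤ (2 ^ (1 + k)) (*-monoʳ-≤ 2
            (≤-trans (m≤m+n (# (λ x → not (E x) ∧ not (ℓ · x))) _)
            (≤-reflexive (sym (#-by-cases (λ x → not (E x)) (ℓ ·_)))))) ⟩
        2 ^ (1 + k) * (2 * # (λ x → not (E x)))
          ≡⟨ ring 2 (λ K s → con 2 :* K :* (con 2 :* s) := con 2 :* (con 2 :* K) :* s) refl (2 ^ k)
            (# (λ x → not (E x))) ⟩
        2 ^ (2 + k) * # (λ x → not (E x))                           ∎) dense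
        where open ≤-Reasoning

-- Covering theorems for t = 2, 3, 4

CoveringTheorem : ℕ → Set
CoveringTheorem t = ∀ {n} (E : 𝔽₂^ n → Bool) → ¬ Flat t E → Dense t E → ¬ ¬ Covered t E

covering₂ : CoveringTheorem 2
covering₂ {n} E no-flat dense not-covered = not-covered (γ ∷ f ∷ [] , λ x e → ¬-not (λ x∈E →
    not-¬ (h x x∈E (∷-injectiveˡ e)) (∷-injectiveˡ (∷-injectiveʳ e))))
  where
  sum-free : SumFree E
  sum-free {x} {y} x∈E y∈E y+x∈E =
      no-flat (extend (extend flat₀ x (λ { [] → trans (cong E (⊕-identityʳ x)) x∈E })) y λ
    { (false ∷ []) → trans (cong E (⊕-identityʳ y)) y∈E
    ; (true ∷ []) → trans (cong (λ t → E (y ⊕ t)) (⊕-identityʳ x)) y+x∈E })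
  N<4E : 2 ^ n < 4 * # E
  N<4E = +-cancelʳ-< (3 * 2 ^ n) _ _ (begin-strict
    2 ^ n + 3 * 2 ^ n                           ≡⟨ cong (4 *_) (sym (#-not E)) ⟩
    4 * (# E + # (λ x → not (E x)))             ≡⟨ *-distribˡ-+ 4 (# E) _ ⟩
    4 * # E + 4 * # (λ x → not (E x))           <⟨ +-monoʳ-< (4 * # E) dense ⟩
    4 * # E + 3 * 2 ^ n                         ∎)
    where open ≤-Reasoning
  cover = sum-free-cover E sum-free N<4E
  γ = proj₁ cover
  f = proj₁ (proj₂ cover)
  h = proj₂ (proj₂ cover)

-- For e in `E` this is the core of the flat spanned by e. As an operation on sets it can be
-- iterated, which `covering₄` does.
pair : ∀ {n} → (𝔽₂^ n → Bool) → 𝔽₂^ n → 𝔽₂^ n → Bool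
pair E e x = E x ∧ E (x ⊕ e)

-- Each coset of a plane contained in E ∪ {0} meets the complement of E; if it does so in f points
-- it contains (4 − f)(3 − f)/2 ≥ 5 − 2f pairs in E.
popular-difference : ∀ {n} (E : 𝔽₂^ n → Bool) → Flat 2 E → ¬ Flat 3 E → Dense 3 E →
  ∃ λ e → e ∈ E × 2 ^ n < 3 * # (pair E e)
popular-difference {n} E P no-flat dense = choose (2 ^ n <? 3 * α) (2 ^ n <? 3 * β) (2 ^ n <? 3 * δ)
  where
  a b : 𝔽₂^ n
  a = φ P (true ∷ false ∷ [])
  b = φ P (false ∷ true ∷ [])
  a+b : φ P (true ∷ true ∷ []) ≡ a ⊕ b
  a+b = additive P (true ∷ false ∷ []) (false ∷ true ∷ [])
  α β δ s : ℕ
  α = # (pair E a)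
  β = # (pair E b)
  δ = # (pair E (a ⊕ b))
  s = # (λ x → not (E x))
  term : 𝔽₂^ n → ℕ
  -- The six pairs within the coset of x, two for each difference, plus twice the number of missing
  -- points.
  term x = (([ pair E a x ] + [ pair E a (x ⊕ b) ]) + ([ pair E b x ] + [ pair E b (x ⊕ a) ]))
         + ([ pair E (a ⊕ b) x ] + [ pair E (a ⊕ b) (x ⊕ a) ])
         + 2 * (([ not (E x) ] + [ not (E (x ⊕ a)) ]) + ([ not (E (x ⊕ b)) ] + [ not (E (x ⊕ (a ⊕ b))) ]))
  count≥5 : ∀ p q r t → ¬ (p ≡ true × q ≡ true × r ≡ true × t ≡ true) →
    5 ≤ (([ p ∧ q ] + [ r ∧ t ]) + ([ p ∧ r ] + [ q ∧ t ])) + ([ p ∧ t ] + [ q ∧ r ]) + 2 *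
        (([ not p ] + [ not q ]) + ([ not r ] + [ not t ]))
  count≥5 true true true true h = ⊥-elim (h (refl , refl , refl , refl))
  count≥5 true true true false h = m≤m+n 5 _
  count≥5 true true false true h = m≤m+n 5 _
  count≥5 true true false false h = m≤m+n 5 _
  count≥5 true false true true h = m≤m+n 5 _
  count≥5 true false true false h = m≤m+n 5 _
  count≥5 true false false true h = m≤m+n 5 _
  count≥5 true false false false h = m≤m+n 5 _
  count≥5 false true true true h = m≤m+n 5 _
  count≥5 false true true false h = m≤m+n 5 _
  count≥5 false true false true h = m≤m+n 5 _
  count≥5 false true false false h = m≤m+n 5 _
  count≥5 false false true true h = m≤m+n 5 _
  count≥5 false false true false h = m≤m+n 5 _
  count≥5 false false false true h = m≤m+n 5 _
  count≥5 false false false false h = m≤m+n 5 _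
  term≥5 : ∀ x → 5 ≤ term x
  term≥5 x
    rewrite solve (x ∷ a ∷ b ∷ []) ((var 0F :+ var 2F) :+ var 1F) (var 0F :+ (var 1F :+ var 2F)) refl
          | solve (x ∷ a ∷ b ∷ []) ((var 0F :+ var 1F) :+ var 2F) (var 0F :+ (var 1F :+ var 2F)) refl
          | solve (x ∷ a ∷ b ∷ []) ((var 0F :+ var 1F) :+ (var 1F :+ var 2F)) (var 0F :+ var 2F) refl
    = count≥5 (E x) (E (x ⊕ a)) (E (x ⊕ b)) (E (x ⊕ (a ⊕ b))) λ { (p , q , r , t) → no-flat (extend P x λ
        { (false ∷ false ∷ []) → trans (cong E (trans (cong (x ⊕_) (φ-0v P)) (⊕-identityʳ x))) p
        ; (true ∷ false ∷ []) → q
        ; (false ∷ true ∷ []) → r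
        ; (true ∷ true ∷ []) → trans (cong (λ y → E (x ⊕ y)) a+b) t }) }
  total : ∑ term ≡ 2 * (α + β + δ) + 8 * s
  total = trans (∑-+ t₁ _) (cong₂ _+_
      (trans (∑-+ t₂ _) (trans (cong₂ _+_
      (trans (∑-+ t₃ _) (cong₂ _+_ (twice (pair E a) b) (twice (pair E b) a)))
      (twice (pair E (a ⊕ b)) a))
      (ring 3 (λ α β δ → (con 2 :* α ⊞ con 2 :* β) ⊞ con 2 :* δ := con 2 :* (α ⊞ β ⊞ δ)) refl α β δ)))
    (trans (∑-*ˡ 2 t₄) (trans (cong (2 *_)
        (trans (∑-+ t₅ _) (cong₂ _+_ (twice (λ x → not (E x)) a)
        (trans (∑-+ t₆ _) (cong₂ _+_ (#-shift b (λ x → not (E x)))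
        (#-shift (a ⊕ b) (λ x → not (E x))))))))
      (ring 1 (λ s → con 2 :* (con 2 :* s ⊞ (s ⊞ s)) := con 8 :* s) refl s))))
    where
    t₁ t₂ t₃ t₄ t₅ t₆ : 𝔽₂^ n → ℕ
    t₃ x = [ pair E a x ] + [ pair E a (x ⊕ b) ]
    t₂ x = t₃ x + ([ pair E b x ] + [ pair E b (x ⊕ a) ])
    t₁ x = t₂ x + ([ pair E (a ⊕ b) x ] + [ pair E (a ⊕ b) (x ⊕ a) ])
    t₅ x = [ not (E x) ] + [ not (E (x ⊕ a)) ]
    t₆ x = [ not (E (x ⊕ b)) ]
    t₄ x = t₅ x + (t₆ x + [ not (E (x ⊕ (a ⊕ b))) ])
    twice : ∀ Q d → ∑ (λ x → [ Q x ] + [ Q (x ⊕ d) ]) ≡ 2 * # Q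
    twice Q d = trans (∑-+ (λ x → [ Q x ]) _) (cong₂ _+_ refl (trans (#-shift d Q) (sym (+-identityʳ (# Q)))))
  lower : 2 ^ n * 5 ≤ 2 * (α + β + δ) + 8 * s
  lower = ≤-trans (≤-reflexive (sym (∑-const {n} 5))) (≤-trans (∑-mono term≥5) (≤-reflexive total))
  -- From 5 N ≤ 2 (α + β + δ) + 8 s and 8 s < 3 N it follows that α + β + δ > N, so one of the three
  -- exceeds N / 3.
  upper : ¬ 2 ^ n < 3 * α → ¬ 2 ^ n < 3 * β → ¬ 2 ^ n < 3 * δ → ⊥
  upper p q r = <⇒≱ (begin-strict
    3 * (2 * (α + β + δ) + 8 * s)
      ≡⟨ ring 4 (λ α β δ s → con 3 :* (con 2 :* (α ⊞ β ⊞ δ) ⊞ con 8 :* s) := con 2 :*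
        (con 3 :* α ⊞ con 3 :* β ⊞ con 3 :* δ) ⊞ con 3 :* (con 8 :* s)) refl α β δ s ⟩
    2 * (3 * α + 3 * β + 3 * δ) + 3 * (8 * s)
      ≤⟨ +-monoˡ-≤ (3 * (8 * s)) (*-monoʳ-≤ 2 (+-mono-≤ (+-mono-≤ (≮⇒≥ p) (≮⇒≥ q)) (≮⇒≥ r))) ⟩
    2 * (2 ^ n + 2 ^ n + 2 ^ n) + 3 * (8 * s)
      <⟨ +-monoʳ-< (2 * (2 ^ n + 2 ^ n + 2 ^ n)) (*-monoʳ-< 3 dense) ⟩
    2 * (2 ^ n + 2 ^ n + 2 ^ n) + 3 * (3 * 2 ^ n)
      ≡⟨ ring 1 (λ N → con 2 :* (N ⊞ N ⊞ N) ⊞ con 3 :* (con 3 :* N) := con 3 :* (N :* con 5)) refl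
        (2 ^ n) ⟩
    3 * (2 ^ n * 5)                                     ∎) (*-monoʳ-≤ 3 lower)
    where open ≤-Reasoning
  choose : _ → _ → _ → ∃ λ e → e ∈ E × 2 ^ n < 3 * # (pair E e)
  choose (yes h) _ _ = a , inside P _ (λ ()) , h
  choose _ (yes h) _ = b , inside P _ (λ ()) , h
  choose _ _ (yes h) = a ⊕ b , trans (cong E (sym a+b)) (inside P _ (λ ())) , h
  choose (no p) (no q) (no r) = ⊥-elim (upper p q r)

Covered-suc : ∀ {n k} {E : 𝔽₂^ n → Bool} → Covered k E → Covered (suc k) E
Covered-suc (F , h) = 0v ∷ F , λ x e → h x (∷-injectiveʳ e)

Dense-pred : ∀ {n} k (E : 𝔽₂^ n → Bool) → Dense (suc k) E → Dense k E
Dense-pred k E = ≤-<-trans (*-monoˡ-≤ (# (λ x → not (E x))) (^-monoʳ-≤ 2 (n≤1+n k)))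

flat₁ : ∀ {n} {E : 𝔽₂^ n → Bool} {e} → e ∈ E → Flat 1 E
flat₁ {E = E} {e} e∈E = extend flat₀ e (λ { [] → trans (cong E (⊕-identityʳ e)) e∈E })

-- Without a plane in `E`, `covering₂` gives a cover with one row to spare. With a plane,
-- `popular-difference` gives an element whose core is large enough for the descent to t = 2. The
-- double negation in `CoveringTheorem` permits this case distinction.
covering₃ : CoveringTheorem 3
covering₃ {n} E no-flat dense not-covered =
    covering₂ E no-plane (Dense-pred 2 E dense) (λ c → not-covered (Covered-suc c))
  where
  no-plane : ¬ Flat 2 E
  no-plane P = cover-by-hyperplane Q no-flat
      (subst (λ t → 2 ^ n < 3 * t) (∑-cong
          (λ x → cong [_] (cong₂ _∧_ (cong E (sym (⊕-identityʳ x)))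
          (cong (λ y → E (x ⊕ y)) (sym (⊕-identityʳ e)))))) large)
      dense (λ E′ → covering₂ E′) not-covered
    where
    pop = popular-difference E P no-flat dense
    e = proj₁ pop
    large = proj₂ (proj₂ pop)
    Q : Flat 1 E
    Q = flat₁ (proj₁ (proj₂ pop))

-- If a solid in `E` contains e, pass to the set of x with x and x + e in `E`. It contains a plane
-- of the solid that avoids e, and a popular difference f of it makes the core of the span of e and
-- f large.
covering₄ : CoveringTheorem 4
covering₄ {n} E no-flat dense not-covered =
    covering₃ E no-solid (Dense-pred 3 E dense) (λ c → not-covered (Covered-suc c))
  where
  no-solid : ¬ Flat 3 E
  no-solid P = cover-by-hyperplane Q no-flat
      (subst (λ t → 2 ^ n < 3 * t) (∑-cong (λ x → cong [_] (unfold x))) large)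
      dense (λ E′ → covering₃ E′) not-covered
    where
    e = φ P (true ∷ 0v)
    e∈E : e ∈ E
    e∈E = inside P _ (λ ())
    E₁ : 𝔽₂^ n → Bool
    E₁ = pair E e
    plane : Flat 2 E₁
    plane .φ c = φ P (false ∷ c)
    plane .additive c d = additive P (false ∷ c) (false ∷ d)
    plane .inside c c≢0 = cong₂ _∧_ (inside P _ (λ { refl → c≢0 refl }))
      (trans (cong E (trans (sym (additive P (false ∷ c) (true ∷ 0v)))
          (cong (λ d → φ P (true ∷ d)) (⊕-identityʳ c)))) (inside P _ (λ ())))
    -- Together with `e`, a flat of rank 3 in `E₁` would give one of rank 4 in `E`.
    no-flat₁ : ¬ Flat 3 E₁
    no-flat₁ R = no-flat (extend R′ e outside)
      where
      R′ : Flat 3 E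
      R′ .φ = φ R
      R′ .additive = additive R
      R′ .inside c c≢0 = ∧-trueˡ (inside R c c≢0)
      outside : ∀ c → e ⊕ φ R c ∈ E
      outside c with ≡-dec Bool._≟_ c 0v
      ... | yes refl = trans (cong E (trans (cong (e ⊕_) (φ-0v R)) (⊕-identityʳ e))) e∈E
      ... | no c≢0 = trans (cong E (⊕-comm e (φ R c))) (∧-trueʳ {E (φ R c)} (inside R c c≢0))
    -- The complement at most doubles, so t drops by one.
    dense₁ : Dense 3 E₁
    dense₁ = ≤-<-trans (begin
      8 * # (λ x → not (E₁ x))    ≤⟨ *-monoʳ-≤ 8 (∑-mono (λ x → not-∧ (E x) (E (x ⊕ e)))) ⟩
      8 * ∑ (λ x → [ not (E x) ] + [ not (E (x ⊕ e)) ])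
                                  ≡⟨ cong (8 *_) (trans (∑-+ (λ x → [ not (E x) ]) _)
                                      (cong₂ _+_ refl (#-shift e (λ x → not (E x))))) ⟩
      8 * (s + s)                 ≡⟨ ring 1 (λ s → con 8 :* (s ⊞ s) := con 16 :* s) refl s ⟩
      16 * s                      ∎) dense
      where
      open ≤-Reasoning
      s = # (λ x → not (E x))
      not-∧ : ∀ p q → [ not (p ∧ q) ] ≤ [ not p ] + [ not q ]
      not-∧ false q = s≤s z≤n
      not-∧ true q = ≤-refl
    pop = popular-difference E₁ plane no-flat₁ dense₁
    f = proj₁ pop
    f∈E₁ : f ∈ E₁
    f∈E₁ = proj₁ (proj₂ pop)
    large = proj₂ (proj₂ pop)
    Q : Flat 2 E
    Q = extend (flat₁ e∈E) f λ
      { (false ∷ []) → trans (cong E (⊕-identityʳ f)) (∧-trueˡ f∈E₁)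
      ; (true ∷ []) → trans (cong (λ t → E (f ⊕ t)) (⊕-identityʳ e)) (∧-trueʳ {E f} f∈E₁) }
    unfold : ∀ x → pair E₁ f x ≡ core Q x
    unfold x = cong₂ _∧_
      (cong₂ _∧_ (cong E (sym (⊕-identityʳ x))) (cong (λ y → E (x ⊕ y)) (sym (⊕-identityʳ e))))
      (cong₂ _∧_ (cong (λ y → E (x ⊕ y)) (sym (⊕-identityʳ f)))
                 (cong E (solve (x ∷ f ∷ e ∷ []) ((var 0F :+ var 1F) :+ var 2F)
                     (var 0F :+ (var 1F :+ (var 2F :+ :0))) refl)))

-- From flats and covers to matroids

additive-matrix : ∀ {k n} (φ : 𝔽₂^ k → 𝔽₂^ n) → φ 0v ≡ 0v → (∀ c d → φ (c ⊕ d) ≡ φ c ⊕ φ d) →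
  Σ (Mat n k) λ ι → ∀ c → apply ι c ≡ φ c
additive-matrix {zero} {n} φ φ0 hom = replicate n [] , λ { [] → trans (apply-[] n) (sym φ0) }
  where
  apply-[] : ∀ n → apply (replicate n []) [] ≡ 0v
  apply-[] zero = refl
  apply-[] (suc n) = cong (false ∷_) (apply-[] n)
additive-matrix {suc k} {n} φ φ0 hom with additive-matrix (λ c → φ (false ∷ c)) φ0
    (λ c d → hom (false ∷ c) (false ∷ d))
... | ι , h = zipWith _∷_ (φ (true ∷ 0v)) ι , correct
  where
  apply-∷ : ∀ {m} (col : 𝔽₂^ m) (ι : Mat m k) b c →
      apply (zipWith _∷_ col ι) (b ∷ c) ≡ (if b then col else 0v) ⊕ apply ι c
  apply-∷ [] [] false c = refl
  apply-∷ [] [] true c = refl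
  apply-∷ (p ∷ col) (row ∷ ι) false c = cong₂ _∷_ (cong (_xor (row · c)) (∧-zeroʳ p)) (apply-∷ col ι false c)
  apply-∷ (p ∷ col) (row ∷ ι) true c =
      cong₂ _∷_ (cong (_xor (row · c)) (∧-identityʳ p)) (apply-∷ col ι true c)
  correct : ∀ c → apply (zipWith _∷_ (φ (true ∷ 0v)) ι) c ≡ φ c
  correct (false ∷ c) = trans (apply-∷ (φ (true ∷ 0v)) ι false c) (trans (⊕-identityˡ _) (h c))
  correct (true ∷ c) = trans (apply-∷ (φ (true ∷ 0v)) ι true c) (trans (cong (φ (true ∷ 0v) ⊕_) (h c))
    (trans (sym (hom (true ∷ 0v) (false ∷ c))) (cong (λ d → φ (true ∷ d)) (⊕-identityˡ c))))

-- If x ≠ y had the same image, the flat would send x + y both to 0 and into the edge set, which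
-- excludes 0.
contains-PG : ∀ M {k} → Flat k (E M) → Contains M (PG k)
contains-PG M {k} P = ι , injective , λ x nz → trans (cong (E M) (h x)) (inside P x (nonzero x nz))
  where
  ι = proj₁ (additive-matrix (φ P) (φ-0v P) (additive P))
  h = proj₂ (additive-matrix (φ P) (φ-0v P) (additive P))
  nonzero : ∀ {m} (x : 𝔽₂^ m) → isNonzero x ≡ true → ¬ x ≡ 0v
  nonzero (false ∷ x) e refl = nonzero x e refl
  injective : ∀ {x y} → apply ι x ≡ apply ι y → x ≡ y
  injective {x} {y} e with ≡-dec Bool._≟_ (x ⊕ y) 0v
  ... | yes z = trans (solve (x ∷ y ∷ []) (var 0F) ((var 0F :+ var 1F) :+ var 1F) refl)
      (trans (cong (_⊕ y) z) (⊕-identityˡ y))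
  ... | no z = ⊥-elim (not-¬ (inside P (x ⊕ y) z) (trans (cong (E M)
        (trans (additive P x y) (trans (cong (_⊕ φ P y) (trans (sym (h x)) (trans e (h y))))
            (⊕-self (φ P y))))) (0∉E M)))

·-comm : ∀ {n} (x y : 𝔽₂^ n) → x · y ≡ y · x
·-comm [] [] = refl
·-comm (a ∷ x) (b ∷ y) = cong₂ _xor_ (∧-comm a b) (·-comm x y)

rowComb-· : ∀ {k n} (F : Mat k n) c x → apply F x ≡ 0v → rowComb F c · x ≡ false
rowComb-· [] [] x e = trans (·-comm 0v x) (·-zeroʳ x)
rowComb-· (row ∷ F) (b ∷ c) x e = trans (·-comm (_ ⊕ rowComb F c) x) (trans (·-distribˡ-⊕ x _ (rowComb F c))
  (cong₂ _xor_ (scaled b) (trans (·-comm x (rowComb F c)) (rowComb-· F c x (∷-injectiveʳ e)))))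
  where
  scaled : ∀ b → x · (if b then row else 0v) ≡ false
  scaled true = trans (·-comm x row) (∷-injectiveˡ e)
  scaled false = ·-zeroʳ x

-- The first row with a nonzero coefficient is a combination of the later ones, so it vanishes
-- wherever they do.
drop-dependent-row : ∀ {k n} (F : Mat (suc k) n) c → ¬ c ≡ 0v → rowComb F c ≡ 0v →
  Σ (Mat k n) λ F′ → ∀ x → apply F′ x ≡ 0v → apply F x ≡ 0v
drop-dependent-row (row ∷ F) (true ∷ c) c≢0 e = F , λ x z →
    cong₂ _∷_ (trans (cong (_· x) row≡) (rowComb-· F c x z)) z
  where
  row≡ : row ≡ rowComb F c
  row≡ = trans (solve (row ∷ rowComb F c ∷ []) (var 0F) ((var 0F :+ var 1F) :+ var 1F) refl)
               (trans (cong (_⊕ rowComb F c) e) (⊕-identityˡ _))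
drop-dependent-row {zero} (row ∷ []) (false ∷ []) c≢0 e = ⊥-elim (c≢0 refl)
drop-dependent-row {suc k} (row ∷ F) (false ∷ c) c≢0 e
  with drop-dependent-row F c (λ z → c≢0 (cong (false ∷_) z)) (trans (sym (⊕-identityˡ _)) e)
... | F′ , h = row ∷ F′ , λ x z → cong₂ _∷_ (∷-injectiveˡ z) (h x (∷-injectiveʳ z))

-- A dependency among the rows allows one to be dropped without enlarging the kernel. Repeating this
-- ends with independent rows, in some number j ≤ k that is not known beforehand.
covered⇒disjoint-subspace : ∀ M k → Covered k (E M) → (∀ j → j ≤ k → ¬ HasDisjointSubspaceOfCodim M j) → ⊥
covered⇒disjoint-subspace M zero (F , h) none = none 0 ≤-refl (F , (λ { [] c≢0 _ → c≢0 refl }) , h)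
covered⇒disjoint-subspace M (suc k) (F , h) none = none (suc k) ≤-refl (F , independent , h)
  where
  independent : IndepRows F
  independent c c≢0 e = let F′ , h′ = drop-dependent-row F c c≢0 e in
    covered⇒disjoint-subspace M k (F′ , λ x z → h x (h′ x z)) (λ j j≤k → none j (m≤n⇒m≤1+n j≤k))

count-++ : ∀ {A : Set} (P : A → Bool) xs ys → count P (xs L.++ ys) ≡ count P xs + count P ys
count-++ P L.[] ys = refl
count-++ P (x L.∷ xs) ys = trans (cong (λ t → [ P x ] + t) (count-++ P xs ys)) (sym (+-assoc [ P x ] _ _))

count-map : ∀ {A B : Set} (P : B → Bool) (g : A → B) xs → count P (L.map g xs) ≡ count (λ x → P (g x)) xs
count-map P g L.[] = refl
count-map P g (x L.∷ xs) = cong (λ t → [ P (g x) ] + t) (count-map P g xs)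

count-allVecs : ∀ {n} (P : 𝔽₂^ n → Bool) → count P (allVecs n) ≡ # P
count-allVecs {zero} P = +-identityʳ _
count-allVecs {suc n} P = trans (count-++ P (L.map (false ∷_) (allVecs n)) _)
  (cong₂ _+_ (trans (count-map P (false ∷_) (allVecs n)) (count-allVecs (half false P)))
             (trans (count-map P (true ∷_) (allVecs n)) (count-allVecs (half true P))))

theorem4p6 : ∀ (M : Matroid) (c : ℕ) →
    CriticalNumber M c →
    ¬ (¬ Contains M (PG 4) × 13 * 2 ^ r M < 16 * size M × 4 < c)
theorem4p6 M c (_ , minimal) (PG-free , large , 4<c) =
  covering₄ (E M) (λ P → PG-free (contains-PG M P)) dense (λ cov →
    covered⇒disjoint-subspace M 4 cov (λ j j≤4 → minimal j (≤-<-trans j≤4 4<c)))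
  where
  dense : Dense 4 (E M)
  -- Edge set and complement make up 2 ^ r vectors, so more than 13/16 for the one leaves less than
  -- 3/16 for the other.
  dense = +-cancelˡ-< (13 * 2 ^ r M) _ _ (begin-strict
    13 * 2 ^ r M + 16 * s                 <⟨ +-monoˡ-< (16 * s) large ⟩
    16 * size M + 16 * s                  ≡⟨ cong (λ t → 16 * t + 16 * s) (count-allVecs (E M)) ⟩
    16 * # (E M) + 16 * s                 ≡⟨ sym (*-distribˡ-+ 16 (# (E M)) s) ⟩
    16 * (# (E M) + s)                    ≡⟨ cong (16 *_) (#-not (E M)) ⟩
    16 * 2 ^ r M                          ≡⟨ *-distribʳ-+ (2 ^ r M) 13 3 ⟩
    13 * 2 ^ r M + 3 * 2 ^ r M            ∎)
    where
    open ≤-Reasoning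
    s = # (λ x → not (E M x))
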